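{- Let $n\ge2$, $1\le p\le n-1$, and $1\le r\le n-p$. Let $\pi\in S_n$ be a $p$-resultant permutation such that $r$ is a left-to-right maximum of $\pi^{\mathrm{left}}=(\pi_1,\dots,\pi_{n-p})$. Suppose the left-to-right maxima of $\pi^{\mathrm{left}}$, in increasing order, are $i_1<\dots<i_a<r<j_1<\dots<j_b$, and $\pi^{\mathrm{right}}=(\pi_{n-p+1},\dots,\pi_n)$ has $k$ right-to-left minima. Let $N_\pi$ be the number of $\sigma\in S_{n-1}$ such that $\sigma^{(r,p)}$ topples to $\pi$. Then $N_\pi=\Delta^{a}\big(B_{b,k}\big)$, where $\Delta$ acts on the first index: $\Delta^{a}(B_{b,k})=\sum_{t=0}^{a}(-1)^{a-t}\binom{a}{t}B_{b+t,k}$.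
   Context: Sites $\{0,1,\dots,n\}$. For $\sigma\in S_{n-1}$, $r\in[n]$, the configuration $\sigma^{(r,p)}$ places on site $i$ ($1\le i\le n-1$) the chip $\sigma_i$ if $\sigma_i<r$ and $\sigma_i+1$ otherwise, plus an extra chip $r$ on site $p$. Toppling: while a site $i$ has at least two chips, pick two chips $\alpha<\beta$ there and move $\alpha$ to $i-1$, $\beta$ to $i+1$; the final configuration is independent of choices, has one chip per site except one, and reading left to right gives the permutation the configuration topples to. $\pi\in S_n$ is $p$-resultant if some configuration of chips $1,\dots,n$ with one chip on each of sites $1,\dots,n-1$ and an extra chip on site $p$ topples to it. A left-to-right maximum of $w$ is $w_j$ with $w_j=\max(w_1,\dots,w_j)$; a right-to-left minimum is an entry smaller than all entries to its right (last entry included). Poly-Bernoulli numbers of type B: $\sum_{n\ge0}B_{n,k}\frac{x^n}{n!}=\frac{\mathrm{Li}_{ -k}(1-e^{ -x})}{1-e^{ -x}}$, $\mathrm{Li}_s(z)=\sum_{i\ge1}z^i/i^s$. -}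

module Defs where

open import Data.Nat as ℕ using (ℕ; zero; suc; _<?_; _≤?_)
open import Data.Nat.Combinatorics using (_C_)
open import Data.Integer as ℤ using (ℤ; +_; -1ℤ; 0ℤ)
open import Data.Bool using (if_then_else_)
open import Data.List using (List; []; _∷_; map; upTo; zip; foldr; length)
open import Data.Bool using (Bool; true; _∧_)
open import Data.List.Relation.Binary.Permutation.Propositional using (_↭_)
open import Data.List.Relation.Unary.Linked using (Linked)
open import Data.Product using (Σ; _×_; _,_)
open import Relation.Nullary.Decidable using (⌊_⌋)
open import Relation.Binary.PropositionalEquality using (_≡_)
open import Relation.Binary.Construct.Closure.ReflexiveTransitive using (Star)

range : ℕ → List ℕ
range m = map suc (upTo m)

sumℤ : List ℤ → ℤ
sumℤ = foldr ℤ._+_ 0ℤ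

-- Chip configurations: list of (chip label, site) pairs (a multiset,
-- compared up to permutation _↭_).

Config : Set
Config = List (ℕ × ℤ)

Step : Config → Config → Set
Step c c' = Σ ℕ λ α → Σ ℕ λ β → Σ ℤ λ s → Σ Config λ rest →
  (α ℕ.< β) ×
  (c ↭ ((α , s) ∷ (β , s) ∷ rest)) ×
  (c' ↭ ((α , s ℤ.- ℤ.1ℤ) ∷ (β , s ℤ.+ ℤ.1ℤ) ∷ rest))

-- a configuration with one chip per occupied site, read left to right, gives π
ReadsAs : Config → List ℕ → Set
ReadsAs c π = Σ (List ℤ) λ ss →
  Linked ℤ._<_ ss × (length ss ≡ length π) × (c ↭ zip π ss)

TopplesTo : Config → List ℕ → Set
TopplesTo c π = Σ Config λ c' → Star Step c c' × ReadsAs c' π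

initConfig : List ℕ → ℕ → ℕ → Config
initConfig w e p = (e , + p) ∷ zip w (map +_ (range (length w)))

shift : ℕ → ℕ → ℕ
shift r x = if ⌊ x <? r ⌋ then x else suc x

sigmaConfig : List ℕ → ℕ → ℕ → Config
sigmaConfig σ r p = initConfig (map (shift r) σ) r p

Resultant : ℕ → ℕ → List ℕ → Set
Resultant n p π = Σ (List ℕ) λ w → Σ ℕ λ e →
  ((e ∷ w) ↭ range n) × (length w ≡ n ℕ.∸ 1) × TopplesTo (initConfig w e p) π

lrGo : ℕ → List ℕ → List ℕ
lrGo m [] = []
lrGo m (x ∷ xs) = if ⌊ m ≤? x ⌋ then x ∷ lrGo x xs else lrGo m xs

lrMaxima : List ℕ → List ℕ
lrMaxima [] = []
lrMaxima (x ∷ xs) = x ∷ lrGo x xs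

allB : (ℕ → Bool) → List ℕ → Bool
allB f [] = true
allB f (x ∷ xs) = f x ∧ allB f xs

rlMinima : List ℕ → List ℕ
rlMinima [] = []
rlMinima (x ∷ xs) =
  if allB (λ y → ⌊ x <? y ⌋) xs then x ∷ rlMinima xs else rlMinima xs

-- Poly-Bernoulli numbers of type B, by coefficient extraction from
--   Li_{-k}(1-e^{-x})/(1-e^{-x}) = Σ_{j≥0} (j+1)^k (1-e^{-x})^j ,
-- where n! [x^n] (1-e^{-x})^j = Σ_{l=0}^{j} C(j,l) (-1)^l (-l)^n
-- and only j ≤ n contribute to [x^n].
polyB : ℕ → ℕ → ℤ
polyB n k = sumℤ (map term (upTo (suc n)))
  where
  term : ℕ → ℤ
  term j = + (suc j ℕ.^ k) ℤ.*
    sumℤ (map (λ l → (-1ℤ ℤ.^ (n ℕ.+ l)) ℤ.* + ((j C l) ℕ.* (l ℕ.^ n)))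
              (upTo (suc j)))

deltaPolyB : ℕ → ℕ → ℕ → ℤ
deltaPolyB a b k =
  sumℤ (map (λ t → (-1ℤ ℤ.^ (a ℕ.∸ t)) ℤ.* (+ (a C t) ℤ.* polyB (b ℕ.+ t) k))
            (upTo (suc a)))

{-# OPTIONS --safe #-}
module Submission where

open import Defs
open import Data.Nat as ℕ using (ℕ; zero; suc; _≤_; _<_; _∸_; z≤n; s≤s; _≤?_; _≟_)
open import Data.Nat using (_<?_)
import Data.Nat.Properties as ℕₚ
open import Data.Nat.Combinatorics
  using (_C_; k>n⇒nCk≡0; nCk+nC[k+1]≡[n+1]C[k+1]; nCk≡nC[n∸k]; nCn≡1)
open import Data.Integer as ℤ using (ℤ; +_; 0ℤ; 1ℤ; -1ℤ)
import Data.Integer.Properties as ℤₚ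
open import Data.Integer.Tactic.RingSolver using (solve-∀)
open import Data.Bool using (true; false)
open import Data.List using (List; []; _∷_; _++_; map; concatMap; length; filter; take; drop; zip;
  upTo; applyUpTo)
open import Data.List.Properties using (∷-injective; map-upTo; map-++; map-∘; map-id-local; length-++; length-map;
  length-upTo; length-take; ++-identityʳ; upTo-∷ʳ; take++drop≡id; filter-accept; filter-reject; filter-all; filter-none)
open import Data.List.Membership.Propositional using (_∈_; _∉_; find; lose)
import Data.List.Membership.Propositional.Properties as ∈ₚ
open import Data.List.Relation.Unary.All as All using (All; []; _∷_; all?)
import Data.List.Relation.Unary.All.Properties as Allₚ
open import Data.List.Relation.Unary.Any using (here; there)
open import Data.List.Relation.Unary.AllPairs using (AllPairs; []; _∷_)
open import Data.List.Relation.Unary.Linked using (Linked; []; [-]; _∷_)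
open import Data.List.Relation.Unary.Linked.Properties using (Linked⇒AllPairs)
open import Data.List.Relation.Unary.Unique.Propositional using (Unique)
import Data.List.Relation.Unary.Unique.Propositional.Properties as Uniqueₚ
open import Data.List.Relation.Binary.Disjoint.Propositional using (Disjoint)
open import Data.List.Relation.Binary.Permutation.Propositional using (_↭_)
open import Data.List.Relation.Binary.Permutation.Propositional as ↭
  using (↭-refl; ↭-reflexive; ↭-sym; ↭-trans; ↭-prep; ↭-swap; ↭⇒↭ₛ)
import Data.List.Relation.Binary.Permutation.Propositional.Properties as ↭ₚ
import Data.List.Relation.Binary.Permutation.Setoid.Properties as ↭ₛₚ
open import Data.Product using (Σ; ∃; ∃₂; _×_; _,_; proj₁; proj₂)
open import Data.Sum using (_⊎_; inj₁; inj₂)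
open import Data.Empty using (⊥)
open import Function using (_∘_)
open import Function.Bundles using (_⇔_; mk⇔)
open import Relation.Nullary using (¬_; Dec; yes; no; contradiction; _×-dec_)
open import Relation.Nullary.Decidable using (⌊_⌋)
open import Relation.Binary.Construct.Closure.ReflexiveTransitive using (Star; ε; _◅_)
open import Relation.Binary.Definitions using (tri<; tri≈; tri>)
open import Relation.Binary.PropositionalEquality
  using (_≡_; _≢_; refl; sym; trans; cong; cong₂; subst; subst₂; setoid; module ≡-Reasoning)

-- Toppling is confluent, so σ^(r,p) may be toppled in a fixed order: the chips r, σ_{p+1}, σ_{p+2}, …
-- are pushed one after the other leftwards through the row of the p chips to their left. Each push
-- sends the minimum of the row and the new chip to π^left, and after the last push the row is π^right.
-- Undoing a push with output d, which requires d to be below the whole row, amounts to choosing a set T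
-- of right-to-left minima of the row: d takes the place of the first chip of T, each chip of T that of
-- the next one, and the last one leaves the row. If T is nonempty then d is in the row, so every output
-- still to be undone has to be smaller than d; hence T is a free choice at the left-to-right maxima of
-- π^left and empty elsewhere. Summed over T, the function c^k of the number k of right-to-left minima
-- becomes (1 − c) c^k + c (c + 1)^k, which is the recurrence of B_{b,k} in b. Undoing the last push has
-- to release r; following r through the row with the weight (c + 1)^q c^m, where q and m count
-- the minima on either side of r, gives the operator Δ once for each left-to-right maximum below r.

-- Poly-Bernoulli numbers

sum< : ℕ → (ℕ → ℤ) → ℤ
sum< n f = sumℤ (applyUpTo f n)

sum<-last : ∀ n f → sum< (suc n) f ≡ sum< n f ℤ.+ f n
sum<-last zero f = trans (ℤₚ.+-identityʳ (f 0)) (sym (ℤₚ.+-identityˡ (f 0)))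
sum<-last (suc n) f = trans (cong (λ z → f 0 ℤ.+ z) (sum<-last n (f ∘ suc)))
  (sym (ℤₚ.+-assoc (f 0) _ _))

sum<-cong : ∀ n {f g} → (∀ i → i < n → f i ≡ g i) → sum< n f ≡ sum< n g
sum<-cong zero eq = refl
sum<-cong (suc n) eq = cong₂ ℤ._+_ (eq 0 (s≤s z≤n)) (sum<-cong n (λ i i<n → eq (suc i) (s≤s i<n)))

sum<-+ : ∀ n f g → sum< n (λ i → f i ℤ.+ g i) ≡ sum< n f ℤ.+ sum< n g
sum<-+ zero f g = refl
sum<-+ (suc n) f g rewrite sum<-+ n (f ∘ suc) (g ∘ suc) = lemma (f 0) (g 0) _ _
  where
  lemma : ∀ a b c d → (a ℤ.+ b) ℤ.+ (c ℤ.+ d) ≡ (a ℤ.+ c) ℤ.+ (b ℤ.+ d)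
  lemma = solve-∀

sum<-* : ∀ n c f → sum< n (λ i → c ℤ.* f i) ≡ c ℤ.* sum< n f
sum<-* zero c f = sym (ℤₚ.*-zeroʳ c)
sum<-* (suc n) c f rewrite sum<-* n c (f ∘ suc) = sym (ℤₚ.*-distribˡ-+ c (f 0) _)

-- The sum Σ_l (-1)^l C(j,l) g(l) as an iterated difference at 0, so that identities follow by
-- induction on `j` without binomial coefficients.
altBinomial : ℕ → (ℕ → ℤ) → ℤ
altBinomial zero g = g 0
altBinomial (suc j) g = altBinomial j g ℤ.- altBinomial j (g ∘ suc)

nC0≡1 : ∀ n → n C 0 ≡ 1
nC0≡1 n = trans (nCk≡nC[n∸k] (z≤n {n})) (nCn≡1 n)

-- Pascal's rule splits the sum for j + 1 into the sum for `g` minus the sum for `g ∘ suc`.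
altBinomial-sum : ∀ j g →
  sum< (suc j) (λ l → (-1ℤ ℤ.^ l) ℤ.* (+ (j C l) ℤ.* g l)) ≡ altBinomial j g
altBinomial-sum zero g = lemma (g 0)
  where
  lemma : ∀ x → 1ℤ ℤ.* (1ℤ ℤ.* x) ℤ.+ 0ℤ ≡ x
  lemma = solve-∀
altBinomial-sum (suc j) g = begin
  sum< (suc (suc j)) (term (suc j) g)
    ≡⟨ cong₂ ℤ._+_ (head-eq) (sum<-cong (suc j) (λ l _ → pascal l)) ⟩
  term j g 0 ℤ.+ sum< (suc j) (λ l → term j g (suc l) ℤ.+ -1ℤ ℤ.* term j (g ∘ suc) l)
    ≡⟨ cong (λ z → term j g 0 ℤ.+ z) (trans (sum<-+ (suc j) (term j g ∘ suc) (λ l → -1ℤ ℤ.* term j (g ∘ suc) l))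
         (cong (λ z → sum< (suc j) (term j g ∘ suc) ℤ.+ z) (sum<-* (suc j) -1ℤ (term j (g ∘ suc))))) ⟩
  term j g 0 ℤ.+ (sum< (suc j) (term j g ∘ suc) ℤ.+ -1ℤ ℤ.* sum< (suc j) (term j (g ∘ suc)))
    ≡⟨ sym (ℤₚ.+-assoc (term j g 0) _ _) ⟩
  sum< (suc (suc j)) (term j g) ℤ.+ -1ℤ ℤ.* sum< (suc j) (term j (g ∘ suc))
    ≡⟨ cong₂ (λ x y → x ℤ.+ -1ℤ ℤ.* y) top (altBinomial-sum j (g ∘ suc)) ⟩
  altBinomial j g ℤ.+ -1ℤ ℤ.* altBinomial j (g ∘ suc)
    ≡⟨ cong (λ z → altBinomial j g ℤ.+ z) (ℤₚ.-1*i≡-i (altBinomial j (g ∘ suc))) ⟩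
  altBinomial (suc j) g ∎
  where
  open ≡-Reasoning
  term : ℕ → (ℕ → ℤ) → ℕ → ℤ
  term j g l = (-1ℤ ℤ.^ l) ℤ.* (+ (j C l) ℤ.* g l)
  head-eq : term (suc j) g 0 ≡ term j g 0
  head-eq = cong (λ c → 1ℤ ℤ.* (+ c ℤ.* g 0)) (trans (nC0≡1 (suc j)) (sym (nC0≡1 j)))
  ring : ∀ s a b x → (-1ℤ ℤ.* s) ℤ.* ((a ℤ.+ b) ℤ.* x) ≡
    (-1ℤ ℤ.* s) ℤ.* (b ℤ.* x) ℤ.+ -1ℤ ℤ.* (s ℤ.* (a ℤ.* x))
  ring = solve-∀
  pascal : ∀ l → term (suc j) g (suc l) ≡ term j g (suc l) ℤ.+ -1ℤ ℤ.* term j (g ∘ suc) l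
  pascal l = trans
    (cong (λ c → (-1ℤ ℤ.^ suc l) ℤ.* (+ c ℤ.* g (suc l))) (sym (nCk+nC[k+1]≡[n+1]C[k+1] j l)))
    (ring (-1ℤ ℤ.^ l) (+ (j C l)) (+ (j C suc l)) (g (suc l)))
  -- The extra last summand carries the factor C(j,j+1) = 0.
  top : sum< (suc (suc j)) (term j g) ≡ altBinomial j g
  top = trans (sum<-last (suc j) (term j g))
    (trans (cong₂ ℤ._+_ (altBinomial-sum j g)
      (trans (cong (λ c → (-1ℤ ℤ.^ suc j) ℤ.* (+ c ℤ.* g (suc j))) (k>n⇒nCk≡0 (ℕₚ.n<1+n j)))
             (ℤₚ.*-zeroʳ (-1ℤ ℤ.^ suc j))))
      (ℤₚ.+-identityʳ _))

altBinomial-cong : ∀ j {f g} → (∀ i → f i ≡ g i) → altBinomial j f ≡ altBinomial j g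
altBinomial-cong zero eq = eq 0
altBinomial-cong (suc j) eq =
  cong₂ ℤ._-_ (altBinomial-cong j eq) (altBinomial-cong j (eq ∘ suc))

altBinomial-+ : ∀ j f g →
  altBinomial j (λ i → f i ℤ.+ g i) ≡ altBinomial j f ℤ.+ altBinomial j g
altBinomial-+ zero f g = refl
altBinomial-+ (suc j) f g
  rewrite altBinomial-+ j f g | altBinomial-+ j (f ∘ suc) (g ∘ suc) =
  lemma (altBinomial j f) (altBinomial j g) _ _
  where
  lemma : ∀ a b c d → (a ℤ.+ b) ℤ.- (c ℤ.+ d) ≡ (a ℤ.- c) ℤ.+ (b ℤ.- d)
  lemma = solve-∀

-- The absorption identity l C(j,l) = j (C(j,l) − C(j−1,l)), summed against g.
altBinomial-absorb : ∀ j g → altBinomial (suc j) (λ l → + l ℤ.* g l) ≡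
  + suc j ℤ.* (altBinomial (suc j) g ℤ.- altBinomial j g)
altBinomial-absorb zero g = lemma (g 0) (g 1)
  where
  lemma : ∀ x y → 0ℤ ℤ.* x ℤ.- 1ℤ ℤ.* y ≡ 1ℤ ℤ.* ((x ℤ.- y) ℤ.- x)
  lemma = solve-∀
altBinomial-absorb (suc j) g = begin
  altBinomial (suc j) (λ l → + l ℤ.* g l) ℤ.- altBinomial (suc j) (λ l → + suc l ℤ.* g (suc l))
    ≡⟨ cong₂ ℤ._-_ (altBinomial-absorb j g)
         (trans (altBinomial-cong (suc j) (λ l → split (+ l) (g (suc l))))
         (trans (altBinomial-+ (suc j) (λ l → + l ℤ.* g (suc l)) (g ∘ suc))
           (cong (ℤ._+ altBinomial (suc j) (g ∘ suc)) (altBinomial-absorb j (g ∘ suc))))) ⟩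
  + suc j ℤ.* (altBinomial (suc j) g ℤ.- altBinomial j g) ℤ.-
    (+ suc j ℤ.* (altBinomial (suc j) (g ∘ suc) ℤ.- altBinomial j (g ∘ suc)) ℤ.+
     altBinomial (suc j) (g ∘ suc))
    ≡⟨ ring (+ suc j) (altBinomial j g) (altBinomial j (g ∘ suc)) (altBinomial (suc j) (g ∘ suc)) ⟩
  + suc (suc j) ℤ.* (altBinomial (suc (suc j)) g ℤ.- altBinomial (suc j) g) ∎
  where
  open ≡-Reasoning
  split : ∀ l x → (1ℤ ℤ.+ l) ℤ.* x ≡ l ℤ.* x ℤ.+ x
  split = solve-∀
  ring : ∀ n a b c →
    n ℤ.* ((a ℤ.- b) ℤ.- a) ℤ.- (n ℤ.* (c ℤ.- b) ℤ.+ c) ≡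
    (1ℤ ℤ.+ n) ℤ.* (((a ℤ.- b) ℤ.- c) ℤ.- (a ℤ.- b))
  ring = solve-∀

-- n! [xⁿ] (1 − e⁻ˣ)ʲ, the coefficient of (j+1)^k in B_{n,k}.
weight : ℕ → ℕ → ℤ
weight n j = (-1ℤ ℤ.^ n) ℤ.* altBinomial j (λ l → + (l ℕ.^ n))

weight-suc-zero : ∀ n → weight (suc n) 0 ≡ 0ℤ
weight-suc-zero n = ℤₚ.*-zeroʳ (-1ℤ ℤ.^ suc n)

-- Coefficient form of d/dx (1 - e⁻ˣ)^(j+1) = (j+1) ((1 - e⁻ˣ)^j - (1 - e⁻ˣ)^(j+1)).
weight-suc-suc : ∀ n j →
  weight (suc n) (suc j) ≡ + suc j ℤ.* (weight n j ℤ.- weight n (suc j))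
weight-suc-suc n j = trans
  (cong ((-1ℤ ℤ.^ suc n) ℤ.*_)
    (trans (altBinomial-cong (suc j) (λ l → ℤₚ.pos-* l (l ℕ.^ n)))
           (altBinomial-absorb j (λ l → + (l ℕ.^ n)))))
  (ring (-1ℤ ℤ.^ n) (+ suc j) (altBinomial (suc j) (λ l → + (l ℕ.^ n))) _)
  where
  ring : ∀ s n a b → (-1ℤ ℤ.* s) ℤ.* (n ℤ.* (a ℤ.- b)) ≡ n ℤ.* (s ℤ.* b ℤ.- s ℤ.* a)
  ring = solve-∀

-- The series (1 - e⁻ˣ)^j has no term below x^j. For n = 0 this is an alternating sum of equal
-- values; the recurrence does the rest.
weight-vanish : ∀ n j → n < j → weight n j ≡ 0ℤ
weight-vanish zero (suc j) _ = trans (ℤₚ.*-identityˡ _) (ℤₚ.+-inverseʳ (altBinomial j (λ _ → 1ℤ)))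
weight-vanish (suc n) (suc j) (s≤s n<j) = trans (weight-suc-suc n j)
  (trans (cong (+ suc j ℤ.*_)
    (cong₂ ℤ._-_ (weight-vanish n j n<j) (weight-vanish n (suc j) (ℕₚ.m<n⇒m<1+n n<j))))
    (ℤₚ.*-zeroʳ (+ suc j)))

-- The transpose of the recurrence `weight-suc-suc`. In terms of c = j + 1 it sends φ to (1 - c)
-- φ(c) + c φ(c + 1), which is also the effect of undoing one push with a free choice of T.
raise : (ℕ → ℤ) → ℕ → ℤ
raise f j = (ℤ.- (+ j)) ℤ.* f j ℤ.+ + suc j ℤ.* f (suc j)

iterRaise : (ℕ → ℤ) → ℕ → ℕ → ℤ
iterRaise f zero = f
iterRaise f (suc n) = raise (iterRaise f n)

iterRaise-shift : ∀ n f j → iterRaise f (suc n) j ≡ iterRaise (raise f) n j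
iterRaise-shift zero f j = refl
iterRaise-shift (suc n) f j =
  cong₂ (λ x y → (ℤ.- (+ j)) ℤ.* x ℤ.+ + suc j ℤ.* y)
    (iterRaise-shift n f j) (iterRaise-shift n f (suc j))

-- Summation by parts: each use of the weight recurrence becomes one `raise` on `f`, until n = 0
-- leaves the single weight 1.
sum-weight : ∀ n f → sum< (suc n) (λ j → f j ℤ.* weight n j) ≡ iterRaise f n 0
sum-weight zero f = lemma (f 0)
  where
  lemma : ∀ x → x ℤ.* (1ℤ ℤ.* 1ℤ) ℤ.+ 0ℤ ≡ x
  lemma = solve-∀
sum-weight (suc n) f = begin
  f 0 ℤ.* weight (suc n) 0 ℤ.+ sum< (suc n) (λ j → f (suc j) ℤ.* weight (suc n) (suc j))
    ≡⟨ cong₂ ℤ._+_ (trans (cong (f 0 ℤ.*_) (weight-suc-zero n)) (ℤₚ.*-zeroʳ (f 0)))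
         (trans (sum<-cong (suc n) (λ j _ →
             trans (cong (f (suc j) ℤ.*_) (weight-suc-suc n j))
                   (ring (f (suc j)) (+ suc j) (weight n j) (weight n (suc j)))))
           (sum<-+ (suc n) up (λ j → -1ℤ ℤ.* down (suc j)))) ⟩
  0ℤ ℤ.+ (sum< (suc n) up ℤ.+ sum< (suc n) (λ j → -1ℤ ℤ.* down (suc j)))
    ≡⟨ ℤₚ.+-identityˡ _ ⟩
  sum< (suc n) up ℤ.+ sum< (suc n) (λ j → -1ℤ ℤ.* down (suc j))
    ≡⟨ cong (λ z → sum< (suc n) up ℤ.+ z)
         (trans (sum<-* (suc n) -1ℤ (down ∘ suc))
         (trans (cong (-1ℤ ℤ.*_) downs) (sym (sum<-* (suc n) -1ℤ down)))) ⟩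
  sum< (suc n) up ℤ.+ sum< (suc n) (λ j → -1ℤ ℤ.* down j)
    ≡⟨ sym (sum<-+ (suc n) up (λ j → -1ℤ ℤ.* down j)) ⟩
  sum< (suc n) (λ j → up j ℤ.+ -1ℤ ℤ.* down j)
    ≡⟨ sum<-cong (suc n) (λ j _ → collect (+ j) (f j) (+ suc j) (f (suc j)) (weight n j)) ⟩
  sum< (suc n) (λ j → raise f j ℤ.* weight n j)
    ≡⟨ sum-weight n (raise f) ⟩
  iterRaise (raise f) n 0
    ≡⟨ sym (iterRaise-shift n f 0) ⟩
  iterRaise f (suc n) 0 ∎
  where
  open ≡-Reasoning
  up down : ℕ → ℤ
  up j = + suc j ℤ.* f (suc j) ℤ.* weight n j
  down j = + j ℤ.* f j ℤ.* weight n j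
  ring : ∀ x s a b → x ℤ.* (s ℤ.* (a ℤ.- b)) ≡ s ℤ.* x ℤ.* a ℤ.+ -1ℤ ℤ.* (s ℤ.* x ℤ.* b)
  ring = solve-∀
  collect : ∀ j x s y w →
    s ℤ.* y ℤ.* w ℤ.+ -1ℤ ℤ.* (j ℤ.* x ℤ.* w) ≡ ((ℤ.- j) ℤ.* x ℤ.+ s ℤ.* y) ℤ.* w
  collect = solve-∀
  -- Both boundary terms vanish, the lower one by its factor 0 and the upper one by `weight-vanish`.
  downs : sum< (suc n) (down ∘ suc) ≡ sum< (suc n) down
  downs = trans (sym (ℤₚ.+-identityˡ _))
    (trans (sum<-last (suc n) down)
    (trans (cong (λ w → sum< (suc n) down ℤ.+ + suc n ℤ.* f (suc n) ℤ.* w)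
             (weight-vanish n (suc n) (ℕₚ.n<1+n n)))
    (trans (cong (λ z → sum< (suc n) down ℤ.+ z) (ℤₚ.*-zeroʳ (+ suc n ℤ.* f (suc n))))
           (ℤₚ.+-identityʳ _))))

sumℤ-map-upTo : ∀ n f → sumℤ (map f (upTo n)) ≡ sum< n f
sumℤ-map-upTo n f = cong sumℤ (map-upTo f n)

-- Entry (a , b , j) is Δᵃ of the b-fold raising of j ↦ (j+1)^k; at j = 0 it is Δᵃ B_{b,k}.
diffB : ℕ → ℕ → ℕ → ℕ → ℤ
diffB zero b j k = iterRaise (λ i → + (suc i ℕ.^ k)) b j
diffB (suc a) b j k = diffB a (suc b) j k ℤ.- diffB a b j k

polyB≡diffB : ∀ n k → polyB n k ≡ diffB 0 n 0 k
polyB≡diffB n k = trans (sumℤ-map-upTo (suc n) outer)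
  (trans (sum<-cong (suc n) {outer} (λ j _ → cong (+ (suc j ℕ.^ k) ℤ.*_) (inner j)))
         (sum-weight n (λ i → + (suc i ℕ.^ k))))
  where
  summand signed : ℕ → ℕ → ℤ
  summand j l = (-1ℤ ℤ.^ (n ℕ.+ l)) ℤ.* + ((j C l) ℕ.* (l ℕ.^ n))
  signed j l = (-1ℤ ℤ.^ l) ℤ.* (+ (j C l) ℤ.* + (l ℕ.^ n))
  outer : ℕ → ℤ
  outer j = + (suc j ℕ.^ k) ℤ.* sumℤ (map (summand j) (upTo (suc j)))
  ring : ∀ s t c x → (s ℤ.* t) ℤ.* (c ℤ.* x) ≡ s ℤ.* (t ℤ.* (c ℤ.* x))
  ring = solve-∀
  inner : ∀ j → sumℤ (map (summand j) (upTo (suc j))) ≡ weight n j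
  inner j = trans (sumℤ-map-upTo (suc j) (summand j))
    (trans (sum<-cong (suc j) {summand j} {λ l → (-1ℤ ℤ.^ n) ℤ.* signed j l} (λ l _ → trans
        (cong₂ ℤ._*_ (ℤₚ.^-distribˡ-+-* -1ℤ n l) (ℤₚ.pos-* (j C l) (l ℕ.^ n)))
        (ring (-1ℤ ℤ.^ n) (-1ℤ ℤ.^ l) (+ (j C l)) (+ (l ℕ.^ n)))))
    (trans (sum<-* (suc j) (-1ℤ ℤ.^ n) (signed j))
           (cong ((-1ℤ ℤ.^ n) ℤ.*_) (altBinomial-sum j (λ l → + (l ℕ.^ n))))))

-1^[a∸t] : ∀ a t → t ≤ a → -1ℤ ℤ.^ (a ∸ t) ≡ (-1ℤ ℤ.^ a) ℤ.* (-1ℤ ℤ.^ t)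
-1^[a∸t] a zero z≤n = sym (ℤₚ.*-identityʳ _)
-1^[a∸t] (suc a) (suc t) (s≤s t≤a) = trans (-1^[a∸t] a t t≤a) (ring (-1ℤ ℤ.^ a) (-1ℤ ℤ.^ t))
  where
  ring : ∀ x y → x ℤ.* y ≡ (-1ℤ ℤ.* x) ℤ.* (-1ℤ ℤ.* y)
  ring = solve-∀

-- With E the shift of `b`, `altBinomial` iterates 1 - E; the sign (-1)^a turns this into Δ = E - 1.
altBinomial-diffB : ∀ a c b k →
  (-1ℤ ℤ.^ a) ℤ.* altBinomial a (λ t → diffB c (b ℕ.+ t) 0 k) ≡ diffB (a ℕ.+ c) b 0 k
altBinomial-diffB zero c b k rewrite ℕₚ.+-identityʳ b = ℤₚ.*-identityˡ _
altBinomial-diffB (suc a) c b k = begin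
  (-1ℤ ℤ.* (-1ℤ ℤ.^ a)) ℤ.* (altBinomial a (λ t → diffB c (b ℕ.+ t) 0 k) ℤ.-
                             altBinomial a (λ t → diffB c (b ℕ.+ suc t) 0 k))
    ≡⟨ ring (-1ℤ ℤ.^ a) (altBinomial a (λ t → diffB c (b ℕ.+ t) 0 k)) _ ⟩
  (-1ℤ ℤ.^ a) ℤ.* altBinomial a (λ t → diffB c (b ℕ.+ suc t) 0 k) ℤ.-
  (-1ℤ ℤ.^ a) ℤ.* altBinomial a (λ t → diffB c (b ℕ.+ t) 0 k)
    ≡⟨ cong (λ z → z ℤ.- (-1ℤ ℤ.^ a) ℤ.* altBinomial a (λ t → diffB c (b ℕ.+ t) 0 k))
         (cong ((-1ℤ ℤ.^ a) ℤ.*_)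
           (altBinomial-cong a (λ t → cong (λ m → diffB c m 0 k) (ℕₚ.+-suc b t)))) ⟩
  (-1ℤ ℤ.^ a) ℤ.* altBinomial a (λ t → diffB c (suc b ℕ.+ t) 0 k) ℤ.-
  (-1ℤ ℤ.^ a) ℤ.* altBinomial a (λ t → diffB c (b ℕ.+ t) 0 k)
    ≡⟨ cong₂ ℤ._-_ (altBinomial-diffB a c (suc b) k) (altBinomial-diffB a c b k) ⟩
  diffB (suc a ℕ.+ c) b 0 k ∎
  where
  open ≡-Reasoning
  ring : ∀ s x y → (-1ℤ ℤ.* s) ℤ.* (x ℤ.- y) ≡ s ℤ.* y ℤ.- s ℤ.* x
  ring = solve-∀

deltaPolyB≡diffB : ∀ a b k → deltaPolyB a b k ≡ diffB a b 0 k
deltaPolyB≡diffB a b k = begin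
  deltaPolyB a b k
    ≡⟨ sumℤ-map-upTo (suc a) summand ⟩
  sum< (suc a) summand
    ≡⟨ sum<-cong (suc a) {summand} (λ { t (s≤s t≤a) → trans
         (cong₂ (λ s x → s ℤ.* (+ (a C t) ℤ.* x)) (-1^[a∸t] a t t≤a) (polyB≡diffB (b ℕ.+ t) k))
         (ℤₚ.*-assoc (-1ℤ ℤ.^ a) (-1ℤ ℤ.^ t) _) }) ⟩
  sum< (suc a) (λ t → (-1ℤ ℤ.^ a) ℤ.* signed t)
    ≡⟨ sum<-* (suc a) (-1ℤ ℤ.^ a) signed ⟩
  (-1ℤ ℤ.^ a) ℤ.* sum< (suc a) signed
    ≡⟨ cong ((-1ℤ ℤ.^ a) ℤ.*_) (altBinomial-sum a (λ t → diffB 0 (b ℕ.+ t) 0 k)) ⟩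
  (-1ℤ ℤ.^ a) ℤ.* altBinomial a (λ t → diffB 0 (b ℕ.+ t) 0 k)
    ≡⟨ altBinomial-diffB a 0 b k ⟩
  diffB (a ℕ.+ 0) b 0 k
    ≡⟨ cong (λ m → diffB m b 0 k) (ℕₚ.+-identityʳ a) ⟩
  diffB a b 0 k ∎
  where
  open ≡-Reasoning
  summand signed : ℕ → ℤ
  summand t = (-1ℤ ℤ.^ (a ∸ t)) ℤ.* (+ (a C t) ℤ.* polyB (b ℕ.+ t) k)
  signed t = (-1ℤ ℤ.^ t) ℤ.* (+ (a C t) ℤ.* diffB 0 (b ℕ.+ t) 0 k)

-- Insertion of a chip into a row and its inverse

-- A chip x arrives at the right end of a row of chips and is pushed leftwards through it;
-- at every site the smaller of the two chips moves on and the larger one stays.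
data Insert : ℕ → List ℕ → ℕ → List ℕ → Set where
  done : ∀ {x} → Insert x [] x []
  keep : ∀ {x y m ys zs} → Insert x ys m zs → m < y → Insert x (y ∷ ys) m (y ∷ zs)
  swap : ∀ {x y m ys zs} → Insert x ys m zs → y < m → Insert x (y ∷ ys) y (m ∷ zs)

data Sweep : List ℕ → List ℕ → List ℕ → List ℕ → Set where
  []  : ∀ {e} → Sweep [] e [] e
  _∷_ : ∀ {x xs d ds e e′ e″} → Insert x e d e′ → Sweep xs e′ ds e″ →
        Sweep (x ∷ xs) e (d ∷ ds) e″

Insert-deterministic : ∀ {x e d d′ e′ e″} →
  Insert x e d e′ → Insert x e d′ e″ → d ≡ d′ × e′ ≡ e″
Insert-deterministic done done = refl , refl
Insert-deterministic (keep i m<y) (keep i′ m′<y) with Insert-deterministic i i′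
... | refl , refl = refl , refl
Insert-deterministic (keep i m<y) (swap i′ y<m′) with Insert-deterministic i i′
... | refl , refl = contradiction m<y (ℕₚ.<-asym y<m′)
Insert-deterministic (swap i y<m) (keep i′ m′<y) with Insert-deterministic i i′
... | refl , refl = contradiction m′<y (ℕₚ.<-asym y<m)
Insert-deterministic (swap i y<m) (swap i′ y<m′) with Insert-deterministic i i′
... | refl , refl = refl , refl

Insert-↭ : ∀ {x e d e′} → Insert x e d e′ → x ∷ e ↭ d ∷ e′
Insert-↭ done = ↭-refl
Insert-↭ (keep i _) = ↭-trans (↭-swap _ _ ↭-refl) (↭-trans (↭-prep _ (Insert-↭ i)) (↭-swap _ _ ↭-refl))
Insert-↭ (swap i _) = ↭-trans (↭-swap _ _ ↭-refl) (↭-prep _ (Insert-↭ i))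

Insert-length : ∀ {x e d e′} → Insert x e d e′ → length e ≡ length e′
Insert-length done = refl
Insert-length (keep i _) = cong suc (Insert-length i)
Insert-length (swap i _) = cong suc (Insert-length i)

Sweep-lengthʳ : ∀ {xs e ds e′} → Sweep xs e ds e′ → length e ≡ length e′
Sweep-lengthʳ [] = refl
Sweep-lengthʳ (i ∷ s) = trans (Insert-length i) (Sweep-lengthʳ s)

Insert-minimum : ∀ {x e d e′} → Insert x e d e′ → All (d <_) e′
Insert-minimum done = []
Insert-minimum (keep i m<y) = m<y ∷ Insert-minimum i
Insert-minimum (swap i y<m) = y<m ∷ All.map (ℕₚ.<-trans y<m) (Insert-minimum i)

Sweep-↭ : ∀ {xs e ds e′} → Sweep xs e ds e′ → xs ++ e ↭ ds ++ e′
Sweep-↭ [] = ↭-refl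
Sweep-↭ {x ∷ xs} {e} {d ∷ ds} (_∷_ {e′ = e₁} i s) =
  ↭-trans (↭-sym (↭ₚ.shift x xs e)) (↭-trans (↭ₚ.++⁺ˡ xs (Insert-↭ i))
    (↭-trans (↭ₚ.shift d xs e₁) (↭-prep d (Sweep-↭ s))))

Unique-resp-↭ : ∀ {A : Set} {xs ys : List A} → xs ↭ ys → Unique xs → Unique ys
Unique-resp-↭ p = ↭ₛₚ.Unique-resp-↭ (setoid _) (↭⇒↭ₛ p)

Unique-++ʳ : ∀ {A : Set} (xs : List A) {ys} → Unique (xs ++ ys) → Unique ys
Unique-++ʳ [] u = u
Unique-++ʳ (x ∷ xs) (_ ∷ u) = Unique-++ʳ xs u

-- A tie between `m` and `y` cannot occur: by `Insert-↭` the chip `m` is `x` or lies in `ys`, and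
-- all chips are distinct.
Insert-total : ∀ x e → Unique (x ∷ e) → ∃₂ λ d e′ → Insert x e d e′
Insert-total x [] u = x , [] , done
Insert-total x (y ∷ ys) ((x≢y ∷ x∉) ∷ (y∉ ∷ u)) with Insert-total x ys (x∉ ∷ u)
... | m , zs , i with ℕₚ.<-cmp m y
...   | tri< m<y _ _ = m , y ∷ zs , keep i m<y
...   | tri> _ _ y<m = y , m ∷ zs , swap i y<m
...   | tri≈ _ refl _ with ↭ₚ.∈-resp-↭ (↭-sym (Insert-↭ i)) (here refl)
...     | here refl = contradiction refl x≢y
...     | there m∈ys = contradiction refl (All.lookup y∉ m∈ys)

Sweep-total : ∀ xs e → Unique (xs ++ e) → ∃₂ λ ds e′ → Sweep xs e ds e′
Sweep-total [] e u = [] , e , []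
Sweep-total (x ∷ xs) e u
  with Insert-total x e (Unique-++ʳ xs (Unique-resp-↭ (↭-sym (↭ₚ.shift x xs e)) u))
... | d , e₁ , i
  with Sweep-total xs e₁ (Unique-++ʳ (d ∷ []) (Unique-resp-↭
         (↭-trans (↭-sym (↭ₚ.shift x xs e)) (↭-trans (↭ₚ.++⁺ˡ xs (Insert-↭ i)) (↭ₚ.shift d xs e₁))) u))
...   | ds , e″ , s = d ∷ ds , e″ , i ∷ s

when : ∀ {A P : Set} → Dec P → List A → List A
when (yes _) xs = xs
when (no _) xs = []

∈-when⁻ : ∀ {A P : Set} (p : Dec P) {x : A} {xs} → x ∈ when p xs → P × x ∈ xs
∈-when⁻ (yes p) x∈ = p , x∈

∈-when⁺ : ∀ {A P : Set} (p : Dec P) {x : A} {xs} → P → x ∈ xs → x ∈ when p xs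
∈-when⁺ (yes _) _ x∈ = x∈
∈-when⁺ (no ¬p) p _ = contradiction p ¬p

Unique-when : ∀ {A P : Set} (p : Dec P) {xs : List A} → (P → Unique xs) → Unique (when p xs)
Unique-when (yes p) u = u p
Unique-when (no _) u = []

cons₂ : ℕ → ℕ × List ℕ → ℕ × List ℕ
cons₂ y (x , zs) = x , y ∷ zs

-- For d below all of e, the pairs (x , zs) with Insert x zs d e other than (d , e).
displace : ℕ → List ℕ → List (ℕ × List ℕ)
displace d [] = []
displace d (y ∷ ys) =
  map (cons₂ y) (displace d ys) ++
  when (all? (y <?_) ys) (map (cons₂ d) ((y , ys) ∷ displace y ys))

uninsert : ℕ → List ℕ → List (ℕ × List ℕ)
uninsert d e = when (all? (d <?_) e) ((d , e) ∷ displace d e)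

prepend : List ℕ → ℕ × List ℕ → List ℕ × List ℕ
prepend xs (x , e) = x ∷ xs , e

unsweep : List ℕ → List ℕ → List (List ℕ × List ℕ)
unsweep [] e = ([] , e) ∷ []
unsweep (d ∷ ds) e =
  concatMap (λ s → map (prepend (proj₁ s)) (uninsert d (proj₂ s))) (unsweep ds e)

-- The last chip of T is released, and `d` stands where the first one was. From there `d` bounds
-- every output still to be undone.
displace-∈ : ∀ {x zs} d e → (x , zs) ∈ displace d e → x ∈ e × d ∈ zs
displace-∈ d (y ∷ ys) p with ∈ₚ.∈-++⁻ (map (cons₂ y) (displace d ys)) p
... | inj₁ q with ∈ₚ.∈-map⁻ (cons₂ y) q
...   | _ , r , refl with displace-∈ d ys r
...     | x∈ , d∈ = there x∈ , there d∈
displace-∈ d (y ∷ ys) p | inj₂ q with ∈-when⁻ (all? (y <?_) ys) q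
...   | _ , here refl = here refl , here refl
...   | _ , there r with ∈ₚ.∈-map⁻ (cons₂ d) r
...     | _ , r′ , refl = there (proj₁ (displace-∈ y ys r′)) , here refl

Insert-unmoved : ∀ d e → All (d <_) e → Insert d e d e
Insert-unmoved d [] [] = done
Insert-unmoved d (y ∷ ys) (d<y ∷ d<ys) = keep (Insert-unmoved d ys d<ys) d<y

displace-sound : ∀ {x zs} d e → All (d <_) e → (x , zs) ∈ displace d e → Insert x zs d e
displace-sound d (y ∷ ys) (d<y ∷ d<ys) p with ∈ₚ.∈-++⁻ (map (cons₂ y) (displace d ys)) p
... | inj₁ q with ∈ₚ.∈-map⁻ (cons₂ y) q
...   | _ , r , refl = keep (displace-sound d ys d<ys r) d<y
displace-sound d (y ∷ ys) (d<y ∷ d<ys) p | inj₂ q with ∈-when⁻ (all? (y <?_) ys) q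
...   | y<ys , here refl = swap (Insert-unmoved y ys y<ys) d<y
...   | y<ys , there r with ∈ₚ.∈-map⁻ (cons₂ d) r
...     | _ , r′ , refl = swap (displace-sound y ys y<ys r′) d<y

uninsert-sound : ∀ {x zs} d e → (x , zs) ∈ uninsert d e → Insert x zs d e
uninsert-sound d e p with ∈-when⁻ (all? (d <?_) e) p
... | d<e , here refl = Insert-unmoved d e d<e
... | d<e , there q = displace-sound d e d<e q

uninsert-complete : ∀ {x zs d e} → Insert x zs d e → (x , zs) ∈ uninsert d e
uninsert-complete {d = d} {e} i = ∈-when⁺ (all? (d <?_) e) (Insert-minimum i) (go i)
  where
  go : ∀ {x zs d e} → Insert x zs d e → (x , zs) ∈ (d , e) ∷ displace d e
  go done = here refl
  go (keep i _) with go i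
  ... | here refl = here refl
  ... | there q = there (∈ₚ.∈-++⁺ˡ (∈ₚ.∈-map⁺ (cons₂ _) q))
  -- The swap left `m` where `y` stood. As the output of `i`, `m` is below all of `zs`, so it may be
  -- the first chip of T; undoing `i` gives the rest of T.
  go (swap {y = y} {m} {zs = zs} i y<m) = there (∈ₚ.∈-++⁺ʳ (map (cons₂ m) (displace y zs))
    (∈-when⁺ (all? (m <?_) zs) (Insert-minimum i) (∈ₚ.∈-map⁺ (cons₂ y) (go i))))

unsweep-sound : ∀ {xs zs} ds e → (xs , zs) ∈ unsweep ds e → Sweep xs zs ds e
unsweep-sound [] e (here refl) = []
unsweep-sound (d ∷ ds) e p
  with find (∈ₚ.∈-concatMap⁻ (λ s → map (prepend (proj₁ s)) (uninsert d (proj₂ s))) {xs = unsweep ds e} p)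
... | (xs , e′) , s∈ , q with ∈ₚ.∈-map⁻ (prepend xs) q
...   | _ , r , refl = uninsert-sound d e′ r ∷ unsweep-sound ds e s∈

unsweep-complete : ∀ {xs zs ds e} → Sweep xs zs ds e → (xs , zs) ∈ unsweep ds e
unsweep-complete [] = here refl
unsweep-complete (i ∷ s) = ∈ₚ.∈-concatMap⁺ _
  (lose (unsweep-complete s) (∈ₚ.∈-map⁺ (prepend _) (uninsert-complete i)))

-- The two families differ at the head of the row: `y` stays there in the first, and the smaller `d`
-- replaces it in the second.
displace-unique : ∀ d e → All (d <_) e → Unique (displace d e)
displace-unique d [] [] = []
displace-unique d (y ∷ ys) (d<y ∷ d<ys) = Uniqueₚ.++⁺
  (Uniqueₚ.map⁺ cons₂-injective (displace-unique d ys d<ys))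
  (Unique-when (all? (y <?_) ys) (λ y<ys → Uniqueₚ.map⁺ cons₂-injective
    (All.tabulate (λ { q refl → ℕₚ.<-irrefl refl (All.lookup y<ys (proj₂ (displace-∈ y ys q))) })
     ∷ displace-unique y ys y<ys)))
  disjoint
  where
  cons₂-injective : ∀ {y s t} → cons₂ y s ≡ cons₂ y t → s ≡ t
  cons₂-injective refl = refl
  disjoint : Disjoint (map (cons₂ y) (displace d ys))
                      (when (all? (y <?_) ys) (map (cons₂ d) ((y , ys) ∷ displace y ys)))
  disjoint (p , q) with ∈ₚ.∈-map⁻ (cons₂ y) p | ∈ₚ.∈-map⁻ (cons₂ d) (proj₂ (∈-when⁻ (all? (y <?_) ys) q))
  ... | _ , _ , refl | _ , _ , refl = ℕₚ.<-irrefl refl d<y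

uninsert-unique : ∀ d e → Unique (uninsert d e)
uninsert-unique d e = Unique-when (all? (d <?_) e) (λ d<e →
  All.tabulate (λ { q refl → ℕₚ.<-irrefl refl (All.lookup d<e (proj₂ (displace-∈ d e q))) })
  ∷ displace-unique d e d<e)

Unique-concatMap : ∀ {A B : Set} (f : A → List B) {xs} → Unique xs → (∀ x → Unique (f x)) →
  (∀ {x y z} → z ∈ f x → z ∈ f y → x ≡ y) → Unique (concatMap f xs)
Unique-concatMap f [] _ _ = []
Unique-concatMap f {x ∷ xs} (x∉ ∷ u) uf inj =
  Uniqueₚ.++⁺ (uf x) (Unique-concatMap f u uf inj) disjoint
  where
  disjoint : Disjoint (f x) (concatMap f xs)
  disjoint (p , q) with find (∈ₚ.∈-concatMap⁻ f {xs = xs} q)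
  ... | y , y∈ , r = All.lookup x∉ y∈ (inj p r)

-- A preimage determines the state it was obtained from: the remaining chips are read off, and the
-- row is recovered by redoing the insertion, which is deterministic.
unsweep-unique : ∀ ds e → Unique (unsweep ds e)
unsweep-unique [] e = [] ∷ []
unsweep-unique (d ∷ ds) e = Unique-concatMap
  (λ s → map (prepend (proj₁ s)) (uninsert d (proj₂ s)))
  (unsweep-unique ds e)
  (λ s → Uniqueₚ.map⁺ (λ { refl → refl }) (uninsert-unique d (proj₂ s)))
  same
  where
  same : ∀ {s t z} → z ∈ map (prepend (proj₁ s)) (uninsert d (proj₂ s)) →
         z ∈ map (prepend (proj₁ t)) (uninsert d (proj₂ t)) → s ≡ t
  same {xs , _} {ys , _} p q with ∈ₚ.∈-map⁻ (prepend xs) p | ∈ₚ.∈-map⁻ (prepend ys) q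
  ... | _ , p′ , refl | _ , q′ , refl =
    cong (xs ,_) (proj₂ (Insert-deterministic (uninsert-sound d _ p′) (uninsert-sound d _ q′)))

-- Sums over the preimages of an insertion

sumOver : ∀ {A : Set} → (A → ℤ) → List A → ℤ
sumOver f xs = sumℤ (map f xs)

sumOver-++ : ∀ {A : Set} (f : A → ℤ) xs ys → sumOver f (xs ++ ys) ≡ sumOver f xs ℤ.+ sumOver f ys
sumOver-++ f [] ys = sym (ℤₚ.+-identityˡ _)
sumOver-++ f (x ∷ xs) ys =
  trans (cong (λ z → f x ℤ.+ z) (sumOver-++ f xs ys)) (sym (ℤₚ.+-assoc (f x) _ _))

sumOver-map : ∀ {A B : Set} (f : B → ℤ) (g : A → B) xs → sumOver f (map g xs) ≡ sumOver (f ∘ g) xs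
sumOver-map f g [] = refl
sumOver-map f g (x ∷ xs) = cong (λ z → f (g x) ℤ.+ z) (sumOver-map f g xs)

sumOver-cong : ∀ {A : Set} {f g : A → ℤ} xs → (∀ {x} → x ∈ xs → f x ≡ g x) →
  sumOver f xs ≡ sumOver g xs
sumOver-cong [] eq = refl
sumOver-cong (x ∷ xs) eq = cong₂ ℤ._+_ (eq (here refl)) (sumOver-cong xs (eq ∘ there))

sumOver-0 : ∀ {A : Set} {f : A → ℤ} xs → (∀ {x} → x ∈ xs → f x ≡ 0ℤ) → sumOver f xs ≡ 0ℤ
sumOver-0 [] eq = refl
sumOver-0 (x ∷ xs) eq rewrite eq (here refl) | sumOver-0 xs (eq ∘ there) = refl

sumOver-+ : ∀ {A : Set} (f g : A → ℤ) xs →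
  sumOver (λ x → f x ℤ.+ g x) xs ≡ sumOver f xs ℤ.+ sumOver g xs
sumOver-+ f g [] = refl
sumOver-+ f g (x ∷ xs) rewrite sumOver-+ f g xs = lemma (f x) (g x) _ _
  where
  lemma : ∀ a b c d → (a ℤ.+ b) ℤ.+ (c ℤ.+ d) ≡ (a ℤ.+ c) ℤ.+ (b ℤ.+ d)
  lemma = solve-∀

sumOver-* : ∀ {A : Set} c (f : A → ℤ) xs → sumOver (λ x → c ℤ.* f x) xs ≡ c ℤ.* sumOver f xs
sumOver-* c f [] = sym (ℤₚ.*-zeroʳ c)
sumOver-* c f (x ∷ xs) rewrite sumOver-* c f xs = sym (ℤₚ.*-distribˡ-+ c (f x) _)

sumOver-concatMap : ∀ {A B : Set} (f : B → ℤ) (g : A → List B) xs →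
  sumOver f (concatMap g xs) ≡ sumOver (λ x → sumOver f (g x)) xs
sumOver-concatMap f g [] = refl
sumOver-concatMap f g (x ∷ xs) =
  trans (sumOver-++ f (g x) (concatMap g xs)) (cong (λ z → sumOver f (g x) ℤ.+ z) (sumOver-concatMap f g xs))

sumOver-iterRaise : ∀ {A : Set} (f : A → ℕ → ℤ) s j xs →
  sumOver (λ x → iterRaise (f x) s j) xs ≡ iterRaise (λ i → sumOver (λ x → f x i) xs) s j
sumOver-iterRaise f zero j xs = refl
sumOver-iterRaise f (suc s) j xs =
  trans (sumOver-+ (λ x → (ℤ.- (+ j)) ℤ.* iterRaise (f x) s j) _ xs)
    (cong₂ ℤ._+_
      (trans (sumOver-* (ℤ.- (+ j)) (λ x → iterRaise (f x) s j) xs)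
             (cong ((ℤ.- (+ j)) ℤ.*_) (sumOver-iterRaise f s j xs)))
      (trans (sumOver-* (+ suc j) (λ x → iterRaise (f x) s (suc j)) xs)
             (cong (+ suc j ℤ.*_) (sumOver-iterRaise f s (suc j) xs))))

iterRaise-cong : ∀ {f g} → (∀ i → f i ≡ g i) → ∀ s j → iterRaise f s j ≡ iterRaise g s j
iterRaise-cong eq zero j = eq j
iterRaise-cong eq (suc s) j =
  cong₂ (λ x y → (ℤ.- (+ j)) ℤ.* x ℤ.+ + suc j ℤ.* y)
    (iterRaise-cong eq s j) (iterRaise-cong eq s (suc j))

branch : {A P : Set} → Dec P → A → A → A
branch (yes _) a b = a
branch (no _) a b = b

branch-yes : ∀ {A P : Set} (p : Dec P) {a b : A} → P → branch p a b ≡ a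
branch-yes (yes _) _ = refl
branch-yes (no ¬p) p = contradiction p ¬p

branch-no : ∀ {A P : Set} (p : Dec P) {a b : A} → ¬ P → branch p a b ≡ b
branch-no (yes p) ¬p = contradiction p ¬p
branch-no (no _) _ = refl

rlCount : List ℕ → ℕ
rlCount e = length (rlMinima e)

allB-true : ∀ x {xs} → All (x <_) xs → allB (λ y → ⌊ x <? y ⌋) xs ≡ true
allB-true x [] = refl
allB-true x {y ∷ ys} (x<y ∷ p) with x <? y
... | yes _ = allB-true x p
... | no x≮y = contradiction x<y x≮y

allB-false : ∀ x xs → ¬ All (x <_) xs → allB (λ y → ⌊ x <? y ⌋) xs ≡ false
allB-false x [] ¬p = contradiction [] ¬p
allB-false x (y ∷ ys) ¬p with x <? y
... | yes x<y = allB-false x ys (λ p → ¬p (x<y ∷ p))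
... | no _ = refl

rlCount-min : ∀ {x xs} → All (x <_) xs → rlCount (x ∷ xs) ≡ suc (rlCount xs)
rlCount-min {x} p rewrite allB-true x p = refl

rlCount-nonmin : ∀ {x xs} → ¬ All (x <_) xs → rlCount (x ∷ xs) ≡ rlCount xs
rlCount-nonmin {x} {xs} ¬p rewrite allB-false x xs ¬p = refl

displace-All : ∀ {m d e x zs} → m < d → All (d <_) e → (x , zs) ∈ displace d e → All (m <_) zs
displace-All {d = d} {e} m<d d<e p =
  All.tail (↭ₚ.All-resp-↭ (↭-sym (Insert-↭ (displace-sound d e d<e p)))
    (m<d ∷ All.map (ℕₚ.<-trans m<d) d<e))

-- A nonempty T leaves `d` in the row, so every larger chip to the left loses its minimality.
displace-nonmin : ∀ {d x y zs} e → d < y → (x , zs) ∈ displace d e → ¬ All (y <_) zs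
displace-nonmin {d} e d<y p y<zs =
  ℕₚ.<-asym d<y (All.lookup y<zs (proj₂ (displace-∈ d e p)))

-- The first sum runs over the sets T without `y`. In the branch, T = {y} gives the single value,
-- and in the last sum `y` takes the place of a later chip of T.
sum-displace : ∀ (f : ℕ × List ℕ → ℤ) d y ys → sumOver f (displace d (y ∷ ys)) ≡
  sumOver (f ∘ cons₂ y) (displace d ys) ℤ.+
  branch (all? (y <?_) ys)
    (f (y , d ∷ ys) ℤ.+ sumOver (f ∘ cons₂ d) (displace y ys)) 0ℤ
sum-displace f d y ys = trans
  (sumOver-++ f (map (cons₂ y) (displace d ys)) _)
  (cong₂ ℤ._+_ (sumOver-map f (cons₂ y) (displace d ys)) (swapped (all? (y <?_) ys)))
  where
  swapped : ∀ {P : Set} (p : Dec P) →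
    sumOver f (when p (map (cons₂ d) ((y , ys) ∷ displace y ys))) ≡
    branch p (f (y , d ∷ ys) ℤ.+ sumOver (f ∘ cons₂ d) (displace y ys)) 0ℤ
  swapped (yes _) = cong (λ z → f (y , d ∷ ys) ℤ.+ z) (sumOver-map f (cons₂ d) (displace y ys))
  swapped (no _) = refl

pow : ℕ → ℕ → ℤ
pow c k = + (c ℕ.^ k)

pow-suc : ∀ c k → pow c (suc k) ≡ + c ℤ.* pow c k
pow-suc c k = ℤₚ.pos-* c (c ℕ.^ k)

-- If the last chip of T is the l-th of the k minima of `e`, the new row has |T| + k - l minima.
-- Summing over the rest of T gives c (c+1)^(l-1) c^(k-l), and the sum over l is geometric.
sum-displace-pow : ∀ c d e → All (d <_) e →
  sumOver (λ z → pow c (rlCount (proj₂ z))) (displace d e) ≡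
  + c ℤ.* (pow (suc c) (rlCount e) ℤ.- pow c (rlCount e))
sum-displace-pow c d [] [] = sym (ℤₚ.*-zeroʳ (+ c))
sum-displace-pow c d (y ∷ ys) (d<y ∷ d<ys) = trans (sum-displace _ d y ys)
  (trans (cong₂ ℤ._+_
           (trans (sumOver-cong (displace d ys)
                    (λ p → cong (pow c) (rlCount-nonmin (displace-nonmin ys d<y p))))
                  (sum-displace-pow c d ys d<ys)) refl)
         (cases (all? (y <?_) ys)))
  where
  ring : ∀ c s t → c ℤ.* (s ℤ.- t) ℤ.+ (c ℤ.* t ℤ.+ c ℤ.* (c ℤ.* (s ℤ.- t))) ≡
    c ℤ.* ((1ℤ ℤ.+ c) ℤ.* s ℤ.- c ℤ.* t)
  ring = solve-∀
  cases : (p : Dec (All (y <_) ys)) →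
    + c ℤ.* (pow (suc c) (rlCount ys) ℤ.- pow c (rlCount ys)) ℤ.+
    branch p (pow c (rlCount (d ∷ ys)) ℤ.+
              sumOver (λ z → pow c (rlCount (d ∷ proj₂ z))) (displace y ys)) 0ℤ ≡
    + c ℤ.* (pow (suc c) (rlCount (y ∷ ys)) ℤ.- pow c (rlCount (y ∷ ys)))
  cases (no ¬p) rewrite rlCount-nonmin ¬p = ℤₚ.+-identityʳ _
  cases (yes p) rewrite rlCount-min p | rlCount-min d<ys | pow-suc (suc c) (rlCount ys) | pow-suc c (rlCount ys)
    = trans (cong (λ z → + c ℤ.* (pow (suc c) (rlCount ys) ℤ.- pow c (rlCount ys)) ℤ.+
                         (+ c ℤ.* pow c (rlCount ys) ℤ.+ z))
        (trans (sumOver-cong (displace y ys) (λ {z} q → trans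
            (cong (pow c) (rlCount-min (displace-All d<y p q)))
            (pow-suc c (rlCount (proj₂ z)))))
        (trans (sumOver-* (+ c) (λ z → pow c (rlCount (proj₂ z))) (displace y ys))
               (cong (+ c ℤ.*_) (sum-displace-pow c y ys p)))))
        (ring (+ c) (pow (suc c) (rlCount ys)) (pow c (rlCount ys)))

-- (c + 1)^q c^m if r is a right-to-left minimum of e with q others before and m after it,
-- and 0 if it is not one.
mark : ℕ → ℕ → List ℕ → ℤ
mark r c [] = 0ℤ
mark r c (y ∷ ys) = branch (all? (y <?_) ys)
  (branch (y ≟ r) (pow c (rlCount ys)) (+ suc c ℤ.* mark r c ys))
  (branch (y ≟ r) 0ℤ (mark r c ys))

mark-∉ : ∀ r c e → r ∉ e → mark r c e ≡ 0ℤ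
mark-∉ r c [] r∉ = refl
mark-∉ r c (y ∷ ys) r∉ with all? (y <?_) ys | y ≟ r
... | _ | yes refl = contradiction (here refl) r∉
... | yes _ | no _ = trans (cong (+ suc c ℤ.*_) (mark-∉ r c ys (r∉ ∘ there))) (ℤₚ.*-zeroʳ (+ suc c))
... | no _ | no _ = mark-∉ r c ys (r∉ ∘ there)

mark-head-min : ∀ {r c ys} → All (r <_) ys → mark r c (r ∷ ys) ≡ pow c (rlCount ys)
mark-head-min {r} {c} {ys} p = trans (branch-yes (all? (r <?_) ys) p) (branch-yes (r ≟ r) refl)

mark-head-nonmin : ∀ {r c ys} → ¬ All (r <_) ys → mark r c (r ∷ ys) ≡ 0ℤ
mark-head-nonmin {r} {c} {ys} p = trans (branch-no (all? (r <?_) ys) p) (branch-yes (r ≟ r) refl)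

mark-min : ∀ {r c y ys} → y ≢ r → All (y <_) ys → mark r c (y ∷ ys) ≡ + suc c ℤ.* mark r c ys
mark-min {r} {c} {y} {ys} y≢r p = trans (branch-yes (all? (y <?_) ys) p) (branch-no (y ≟ r) y≢r)

mark-nonmin : ∀ {r c y ys} → y ≢ r → ¬ All (y <_) ys → mark r c (y ∷ ys) ≡ mark r c ys
mark-nonmin {r} {c} {y} {ys} y≢r p = trans (branch-no (all? (y <?_) ys) p) (branch-no (y ≟ r) y≢r)

<-∉ : ∀ {r e} → All (r <_) e → r ∉ e
<-∉ p q = ℕₚ.<-irrefl refl (All.lookup p q)

-- Being below the whole row, `r` becomes the leftmost right-to-left minimum wherever it lands. Its
-- weight is c to the number of the other minima, one factor c less than in `sum-displace-pow`.
sum-displace-arrival : ∀ c r e → All (r <_) e →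
  sumOver (λ z → mark r c (proj₂ z)) (displace r e) ≡
  pow (suc c) (rlCount e) ℤ.- pow c (rlCount e)
sum-displace-arrival c r [] [] = refl
sum-displace-arrival c r (y ∷ ys) (r<y ∷ r<ys) = trans (sum-displace _ r y ys)
  (trans (cong₂ ℤ._+_
           (trans (sumOver-cong (displace r ys) (λ p → mark-nonmin {c = c} (ℕₚ.>⇒≢ r<y) (displace-nonmin ys r<y p)))
                  (sum-displace-arrival c r ys r<ys)) refl)
         (cases (all? (y <?_) ys)))
  where
  ring : ∀ c s t → (s ℤ.- t) ℤ.+ (t ℤ.+ c ℤ.* (s ℤ.- t)) ≡ (1ℤ ℤ.+ c) ℤ.* s ℤ.- c ℤ.* t
  ring = solve-∀
  cases : (p : Dec (All (y <_) ys)) →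
    (pow (suc c) (rlCount ys) ℤ.- pow c (rlCount ys)) ℤ.+
    branch p (mark r c (r ∷ ys) ℤ.+
              sumOver (λ z → mark r c (r ∷ proj₂ z)) (displace y ys)) 0ℤ ≡
    pow (suc c) (rlCount (y ∷ ys)) ℤ.- pow c (rlCount (y ∷ ys))
  cases (no ¬p) rewrite rlCount-nonmin ¬p = ℤₚ.+-identityʳ _
  cases (yes p) rewrite rlCount-min p | pow-suc (suc c) (rlCount ys) | pow-suc c (rlCount ys) =
    trans (cong₂ (λ x z → (pow (suc c) (rlCount ys) ℤ.- pow c (rlCount ys)) ℤ.+ (x ℤ.+ z))
        (mark-head-min {c = c} r<ys)
        (trans (sumOver-cong (displace y ys) (λ q → mark-head-min {c = c} (displace-All r<y p q)))
               (sum-displace-pow c y ys p)))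
      (ring (+ c) (pow (suc c) (rlCount ys)) (pow c (rlCount ys)))

-- The induction of `sum-displace-pow`, with factor c + 1 for a minimum before `r`. When `r` itself
-- is at the head and belongs to T, it either leaves the row, with weight 0, or moves to a later
-- place, which `sum-displace-arrival` counts.
sum-displace-mark : ∀ c r d e → d ≢ r → All (d <_) e →
  sumOver (λ z → mark r c (proj₂ z)) (displace d e) ≡
  + suc c ℤ.* (mark r (suc c) e ℤ.- mark r c e)
sum-displace-mark c r d [] d≢r [] = sym (ℤₚ.*-zeroʳ (+ suc c))
sum-displace-mark c r d (y ∷ ys) d≢r (d<y ∷ d<ys) =
  trans (sum-displace _ d y ys) (cases (all? (y <?_) ys) (y ≟ r))
  where
  S : ℤ
  S = sumOver (λ z → mark r c (y ∷ proj₂ z)) (displace d ys)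
  T : ℤ
  T = sumOver (λ z → mark r c (d ∷ proj₂ z)) (displace y ys)
  S≡0 : y ≡ r → S ≡ 0ℤ
  S≡0 refl = sumOver-0 (displace d ys) (λ p → mark-head-nonmin {c = c} (displace-nonmin ys d<y p))
  S≡ : y ≢ r → S ≡ + suc c ℤ.* (mark r (suc c) ys ℤ.- mark r c ys)
  S≡ y≢r = trans
    (sumOver-cong (displace d ys) (λ p → mark-nonmin {c = c} y≢r (displace-nonmin ys d<y p)))
    (sum-displace-mark c r d ys d≢r d<ys)
  T≡ : All (y <_) ys →
    T ≡ + suc c ℤ.* sumOver (λ z → mark r c (proj₂ z)) (displace y ys)
  T≡ p = trans
    (sumOver-cong (displace y ys) (λ q → mark-min {c = c} d≢r (displace-All d<y p q)))
    (sumOver-* (+ suc c) (λ z → mark r c (proj₂ z)) (displace y ys))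
  ring₀ : ∀ n z → 0ℤ ℤ.+ (n ℤ.* 0ℤ ℤ.+ n ℤ.* z) ≡ n ℤ.* z
  ring₀ = solve-∀
  ring₁ : ∀ n s t → n ℤ.* (s ℤ.- t) ℤ.+ (n ℤ.* t ℤ.+ n ℤ.* (n ℤ.* (s ℤ.- t))) ≡
    n ℤ.* ((1ℤ ℤ.+ n) ℤ.* s ℤ.- n ℤ.* t)
  ring₁ = solve-∀
  cases : (p : Dec (All (y <_) ys)) → Dec (y ≡ r) →
    S ℤ.+ branch p (mark r c (d ∷ ys) ℤ.+ T) 0ℤ ≡
    + suc c ℤ.* (mark r (suc c) (y ∷ ys) ℤ.- mark r c (y ∷ ys))
  cases (no ¬p) (yes refl) = trans (cong (λ z → z ℤ.+ 0ℤ) (S≡0 refl))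
    (sym (trans (cong₂ (λ s t → + suc c ℤ.* (s ℤ.- t)) (mark-head-nonmin {c = suc c} ¬p) (mark-head-nonmin {c = c} ¬p))
                (ℤₚ.*-zeroʳ (+ suc c))))
  cases (no ¬p) (no y≢r) = trans (ℤₚ.+-identityʳ S) (trans (S≡ y≢r)
    (sym (cong₂ (λ s t → + suc c ℤ.* (s ℤ.- t)) (mark-nonmin {c = suc c} y≢r ¬p) (mark-nonmin {c = c} y≢r ¬p))))
  cases (yes p) (yes refl) = trans
    (cong₂ ℤ._+_ (S≡0 refl) (cong₂ ℤ._+_
      (trans (mark-min {c = c} d≢r d<ys) (cong (+ suc c ℤ.*_) (mark-∉ r c ys (<-∉ p))))
      (trans (T≡ p) (cong (+ suc c ℤ.*_) (sum-displace-arrival c r ys p)))))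
    (trans (ring₀ (+ suc c) _)
      (sym (cong₂ (λ s t → + suc c ℤ.* (s ℤ.- t)) (mark-head-min {c = suc c} p) (mark-head-min {c = c} p))))
  cases (yes p) (no y≢r) = trans
    (cong₂ ℤ._+_ (S≡ y≢r) (cong₂ ℤ._+_ (mark-min {c = c} d≢r d<ys)
      (trans (T≡ p) (cong (+ suc c ℤ.*_) (sum-displace-mark c r y ys y≢r p)))))
    (trans (ring₁ (+ suc c) (mark r (suc c) ys) (mark r c ys))
      (sym (cong₂ (λ s t → + suc c ℤ.* (s ℤ.- t)) (mark-min {c = suc c} y≢r p) (mark-min {c = c} y≢r p))))

isChip : ℕ → ℕ → ℤ
isChip r x = branch (x ≟ r) 1ℤ 0ℤ

isChip-≢ : ∀ {r x} → x ≢ r → isChip r x ≡ 0ℤ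
isChip-≢ {r} {x} = branch-no (x ≟ r)

-- The released chip is the last one of T. If it is `r`, the rest of T is any set of the q minima
-- before `r`: 2^q choices, the mark at c = 1.
sum-displace-exit : ∀ r d e → Unique e →
  sumOver (λ z → isChip r (proj₁ z)) (displace d e) ≡ mark r 1 e
sum-displace-exit r d [] u = refl
sum-displace-exit r d (y ∷ ys) (y∉ys ∷ u) = trans (sum-displace _ d y ys)
  (trans (cong₂ ℤ._+_ (sum-displace-exit r d ys u) refl)
         (cases (all? (y <?_) ys) (y ≟ r)))
  where
  T : ℤ
  T = sumOver (λ z → isChip r (proj₁ z)) (displace y ys)
  y∉ : y ∉ ys
  y∉ q = All.lookup y∉ys q refl
  ring : ∀ s → s ℤ.+ (0ℤ ℤ.+ s) ≡ (1ℤ ℤ.+ 1ℤ) ℤ.* s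
  ring = solve-∀
  cases : (p : Dec (All (y <_) ys)) → Dec (y ≡ r) →
    mark r 1 ys ℤ.+ branch p (isChip r y ℤ.+ T) 0ℤ ≡ mark r 1 (y ∷ ys)
  cases (no ¬p) (yes refl) = trans (ℤₚ.+-identityʳ _)
    (trans (mark-∉ r 1 ys y∉) (sym (mark-head-nonmin {c = 1} ¬p)))
  cases (no ¬p) (no y≢r) = trans (ℤₚ.+-identityʳ _) (sym (mark-nonmin {c = 1} y≢r ¬p))
  cases (yes p) (yes refl) = trans
    (cong₂ ℤ._+_ (mark-∉ r 1 ys y∉) (cong₂ ℤ._+_ (branch-yes (y ≟ y) refl)
      (trans (sum-displace-exit r y ys u) (mark-∉ r 1 ys y∉))))
    (sym (trans (mark-head-min {c = 1} p) (cong +_ (ℕₚ.^-zeroˡ (rlCount ys)))))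
  cases (yes p) (no y≢r) = trans
    (cong (λ z → mark r 1 ys ℤ.+ z) (cong₂ ℤ._+_ (isChip-≢ y≢r) (sum-displace-exit r y ys u)))
    (trans (ring (mark r 1 ys)) (sym (mark-min {c = 1} y≢r p)))

sumOver-- : ∀ {A : Set} (f g : A → ℤ) xs →
  sumOver (λ x → f x ℤ.- g x) xs ≡ sumOver f xs ℤ.- sumOver g xs
sumOver-- f g [] = refl
sumOver-- f g (x ∷ xs) rewrite sumOver-- f g xs = lemma (f x) (g x) _ _
  where
  lemma : ∀ a b c d → (a ℤ.- b) ℤ.+ (c ℤ.- d) ≡ (a ℤ.+ c) ℤ.- (b ℤ.+ d)
  lemma = solve-∀

-- `raise` is linear and hence commutes with Δ.
diffB-raise : ∀ a b j k → diffB a (suc b) j k ≡ raise (λ i → diffB a b i k) j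
diffB-raise zero b j k = refl
diffB-raise (suc a) b j k = trans
  (cong₂ ℤ._-_ (diffB-raise a (suc b) j k) (diffB-raise a b j k))
  (ring (+ j) (+ suc j) (diffB a (suc b) j k) _ (diffB a b j k) _)
  where
  ring : ∀ j s a b c d →
    ((ℤ.- j) ℤ.* a ℤ.+ s ℤ.* b) ℤ.- ((ℤ.- j) ℤ.* c ℤ.+ s ℤ.* d) ≡
    (ℤ.- j) ℤ.* (a ℤ.- c) ℤ.+ s ℤ.* (b ℤ.- d)
  ring = solve-∀

-- The weights of the marked chip follow the Δ-recurrence up to the factor j + 1, which is 1 at j = 0.
diffB-arrival : ∀ s j k →
  + suc j ℤ.* iterRaise (λ c → pow (suc c) k ℤ.- pow c k) s (suc j) ≡ diffB (suc s) 0 j k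
diffB-arrival zero j k = ring (+ j) (pow (suc j) k) (pow (suc (suc j)) k)
  where
  ring : ∀ j a b → (1ℤ ℤ.+ j) ℤ.* (b ℤ.- a) ≡ ((ℤ.- j) ℤ.* a ℤ.+ (1ℤ ℤ.+ j) ℤ.* b) ℤ.- a
  ring = solve-∀
diffB-arrival (suc s) j k = trans
  (ring₁ (+ suc j) (+ suc (suc j)) (I (suc j)) (I (suc (suc j))))
  (trans (cong₂ (λ x y → + suc j ℤ.* (y ℤ.- x)) (diffB-arrival s j k) (diffB-arrival s (suc j) k))
  (trans (ring₂ (+ j) (diffB (suc s) 0 j k) (diffB (suc s) 0 (suc j) k))
         (cong (λ z → z ℤ.- diffB (suc s) 0 j k) (sym (diffB-raise (suc s) 0 j k)))))
  where
  I : ℕ → ℤ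
  I = iterRaise (λ c → pow (suc c) k ℤ.- pow c k) s
  ring₁ : ∀ m n a b → m ℤ.* ((ℤ.- m) ℤ.* a ℤ.+ n ℤ.* b) ≡ m ℤ.* (n ℤ.* b ℤ.- m ℤ.* a)
  ring₁ = solve-∀
  ring₂ : ∀ j a b → (1ℤ ℤ.+ j) ℤ.* (b ℤ.- a) ≡ ((ℤ.- j) ℤ.* a ℤ.+ (1ℤ ℤ.+ j) ℤ.* b) ℤ.- a
  ring₂ = solve-∀

preimages : ℕ → List ℕ → List (ℕ × List ℕ)
preimages d e = (d , e) ∷ displace d e

-- The empty T and `sum-displace-pow` add up to c^k + c ((c+1)^k - c^k), which is `raise` of the
-- powers at c = j + 1. Linearity extends this to iterates and differences.
sum-preimages-diffB : ∀ a b j d e → All (d <_) e →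
  sumOver (λ z → diffB a b j (rlCount (proj₂ z))) (preimages d e) ≡ diffB a (suc b) j (rlCount e)
sum-preimages-diffB zero b j d e d<e = trans
  (sumOver-iterRaise (λ z i → pow (suc i) (rlCount (proj₂ z))) b j (preimages d e))
  (trans (iterRaise-cong (λ i → trans
           (cong (λ z → pow (suc i) (rlCount e) ℤ.+ z) (sum-displace-pow (suc i) d e d<e))
           (ring (+ i) (pow (suc i) (rlCount e)) (pow (suc (suc i)) (rlCount e)))) b j)
         (sym (iterRaise-shift b (λ i → pow (suc i) (rlCount e)) j)))
  where
  ring : ∀ i a b → a ℤ.+ (1ℤ ℤ.+ i) ℤ.* (b ℤ.- a) ≡ (ℤ.- i) ℤ.* a ℤ.+ (1ℤ ℤ.+ i) ℤ.* b
  ring = solve-∀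
sum-preimages-diffB (suc a) b j d e d<e = trans
  (sumOver-- (λ z → diffB a (suc b) j (rlCount (proj₂ z))) _ (preimages d e))
  (cong₂ ℤ._-_ (sum-preimages-diffB a (suc b) j d e d<e) (sum-preimages-diffB a b j d e d<e))

-- Here the index of `raise` is c itself, whereas index j of `diffB` stands for c = j + 1. It starts
-- at 1, the value found in `sum-displace-exit`.
marks : ℕ → ℕ → List ℕ → ℤ
marks r s e = iterRaise (λ c → mark r c e) s 1

sum-preimages-marks : ∀ r s d e → d ≢ r → All (d <_) e →
  sumOver (λ z → marks r s (proj₂ z)) (preimages d e) ≡ marks r (suc s) e
sum-preimages-marks r s d e d≢r d<e = trans
  (sumOver-iterRaise (λ z c → mark r c (proj₂ z)) s 1 (preimages d e))
  (trans (iterRaise-cong (λ c → trans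
           (cong (λ z → mark r c e ℤ.+ z) (sum-displace-mark c r d e d≢r d<e))
           (ring (+ c) (mark r c e) (mark r (suc c) e))) s 1)
         (sym (iterRaise-shift s (λ c → mark r c e) 1)))
  where
  ring : ∀ i a b → a ℤ.+ (1ℤ ℤ.+ i) ℤ.* (b ℤ.- a) ≡ (ℤ.- i) ℤ.* a ℤ.+ (1ℤ ℤ.+ i) ℤ.* b
  ring = solve-∀

-- With T empty, `r` is released at once and is absent from the row, so the mark is 0. The other
-- choices are summed by `sum-displace-arrival`, and `diffB-arrival` at j = 0 converts the result.
sum-preimages-arrival : ∀ r s e → All (r <_) e →
  sumOver (λ z → marks r s (proj₂ z)) (preimages r e) ≡ diffB (suc s) 0 0 (rlCount e)
sum-preimages-arrival r s e r<e = trans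
  (sumOver-iterRaise (λ z c → mark r c (proj₂ z)) s 1 (preimages r e))
  (trans (iterRaise-cong (λ c → trans
           (cong₂ ℤ._+_ (mark-∉ r c e (<-∉ r<e)) (sum-displace-arrival c r e r<e))
           (ℤₚ.+-identityˡ _)) s 1)
  (trans (sym (ℤₚ.*-identityˡ _)) (diffB-arrival s 0 (rlCount e))))

-- Sums over the preimages of a sweep

guard : ℕ → List ℕ → ℤ → ℤ
guard m e v = branch (all? (m <?_) e) v 0ℤ

guard-yes : ∀ {m e v} → All (m <_) e → guard m e v ≡ v
guard-yes {m} {e} = branch-yes (all? (m <?_) e)

guard-no : ∀ {m e v} → ¬ All (m <_) e → guard m e v ≡ 0ℤ
guard-no {m} {e} = branch-no (all? (m <?_) e)

guard-cong : ∀ m e {v w} → (All (m <_) e → v ≡ w) → guard m e v ≡ guard m e w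
guard-cong m e eq with all? (m <?_) e
... | yes p = eq p
... | no _ = refl

sum-uninsert : ∀ (f : ℕ × List ℕ → ℤ) d e →
  sumOver f (uninsert d e) ≡ guard d e (sumOver f (preimages d e))
sum-uninsert f d e with all? (d <?_) e
... | yes _ = refl
... | no _ = refl

-- All chips of the new row are at least `d`, so the guard of `m` holds automatically and T is a
-- free choice.
sum-uninsert-record : ∀ (f : List ℕ → ℤ) {m d} e → m < d →
  sumOver (λ z → guard m (proj₂ z) (f (proj₂ z))) (uninsert d e) ≡
  guard d e (sumOver (f ∘ proj₂) (preimages d e))
sum-uninsert-record f {m} {d} e m<d = trans (sum-uninsert _ d e) (guard-cong d e (λ d<e →
  cong₂ ℤ._+_ (guard-yes (All.map (ℕₚ.<-trans m<d) d<e))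
    (sumOver-cong (displace d e) (λ p → guard-yes (displace-All m<d d<e p)))))

-- A nonempty T would leave `d` in the row, where the guard of `m` fails. Only the empty T remains,
-- and the guard of `m` implies that of `d`.
sum-uninsert-nonrecord : ∀ (f : List ℕ → ℤ) {m d} e → d < m →
  sumOver (λ z → guard m (proj₂ z) (f (proj₂ z))) (uninsert d e) ≡ guard m e (f e)
sum-uninsert-nonrecord f {m} {d} e d<m = trans (sum-uninsert _ d e)
  (trans (guard-cong d e (λ _ → trans
      (cong (λ z → guard m e (f e) ℤ.+ z) (sumOver-0 (displace d e) (λ p → guard-no (displace-nonmin e d<m p))))
      (ℤₚ.+-identityʳ _)))
    (collapse (all? (m <?_) e)))
  where
  collapse : Dec (All (m <_) e) → guard d e (guard m e (f e)) ≡ guard m e (f e)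
  collapse (yes p) = guard-yes (All.map (ℕₚ.<-trans d<m) p)
  collapse (no ¬p) with all? (d <?_) e
  ... | yes _ = refl
  ... | no _ = sym (guard-no ¬p)

sum-unsweep : ∀ (f : List ℕ → ℤ) d ds e →
  sumOver (f ∘ proj₂) (unsweep (d ∷ ds) e) ≡
  sumOver (λ s → sumOver (f ∘ proj₂) (uninsert d (proj₂ s))) (unsweep ds e)
sum-unsweep f d ds e = trans (sumOver-concatMap (f ∘ proj₂) _ (unsweep ds e))
  (sumOver-cong (unsweep ds e) (λ {s} _ →
    sumOver-map (f ∘ proj₂) (prepend (proj₁ s)) (uninsert d (proj₂ s))))

-- In use, `m` is the last left-to-right maximum read before `ds`. Its push is undone after those of
-- `ds`, so the row they lead back to has to lie above `m`.
guarded : ℕ → (List ℕ → ℤ) → List ℕ → List ℕ → ℤ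
guarded m f ds e = sumOver (λ s → guard m (proj₂ s) (f (proj₂ s))) (unsweep ds e)

guarded-record : ∀ (f g : List ℕ → ℤ) {m d} ds e → m < d →
  (∀ e → All (d <_) e → sumOver (f ∘ proj₂) (preimages d e) ≡ g e) →
  guarded m f (d ∷ ds) e ≡ guarded d g ds e
guarded-record f g {m} {d} ds e m<d eq =
  trans (sum-unsweep (λ e → guard m e (f e)) d ds e) (sumOver-cong (unsweep ds e) (λ {s} _ →
    trans (sum-uninsert-record f (proj₂ s) m<d) (guard-cong d (proj₂ s) (eq (proj₂ s)))))

guarded-nonrecord : ∀ (f : List ℕ → ℤ) {m d} ds e → d < m →
  guarded m f (d ∷ ds) e ≡ guarded m f ds e
guarded-nonrecord f {m} {d} ds e d<m =
  trans (sum-unsweep (λ e → guard m e (f e)) d ds e) (sumOver-cong (unsweep ds e) (λ {s} _ →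
    sum-uninsert-nonrecord f (proj₂ s) d<m))

lrGo-record : ∀ {m d} ds → m < d → lrGo m (d ∷ ds) ≡ d ∷ lrGo d ds
lrGo-record {m} {d} ds m<d with m ≤? d
... | yes _ = refl
... | no m≰d = contradiction (ℕₚ.<⇒≤ m<d) m≰d

lrGo-nonrecord : ∀ {m d} ds → d < m → lrGo m (d ∷ ds) ≡ lrGo m ds
lrGo-nonrecord {m} {d} ds d<m with m ≤? d
... | yes m≤d = contradiction m≤d (ℕₚ.<⇒≱ d<m)
... | no _ = refl

lrGo-> : ∀ m ds → Unique (m ∷ ds) → All (m <_) (lrGo m ds)
lrGo-> m [] u = []
lrGo-> m (d ∷ ds) ((m≢d ∷ m∉) ∷ u) with ℕₚ.<-cmp m d
... | tri< m<d _ _ rewrite lrGo-record ds m<d = m<d ∷ All.map (ℕₚ.<-trans m<d) (lrGo-> d ds u)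
... | tri≈ _ m≡d _ = contradiction m≡d m≢d
... | tri> _ _ d<m rewrite lrGo-nonrecord ds d<m with u
...   | _ ∷ u′ = lrGo-> m ds (m∉ ∷ u′)

-- Each new maximum replaces `b` by b + 1 through `sum-preimages-diffB`; the other outputs change
-- nothing.
guarded-diffB : ∀ a b m ds e → Unique (m ∷ ds) → All (λ d → All (d <_) e) (m ∷ ds) →
  guarded m (λ e → diffB a b 0 (rlCount e)) ds e ≡ diffB a (b ℕ.+ length (lrGo m ds)) 0 (rlCount e)
guarded-diffB a b m [] e u (m<e ∷ []) = trans (ℤₚ.+-identityʳ _)
  (trans (guard-yes m<e) (cong (λ b → diffB a b 0 (rlCount e)) (sym (ℕₚ.+-identityʳ b))))
guarded-diffB a b m (d ∷ ds) e ((m≢d ∷ m∉) ∷ u) (m<e ∷ d<e ∷ ds<e) with ℕₚ.<-cmp m d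
... | tri< m<d _ _ rewrite lrGo-record ds m<d = trans
  (guarded-record _ (λ e → diffB a (suc b) 0 (rlCount e)) ds e m<d (λ e → sum-preimages-diffB a b 0 d e))
  (trans (guarded-diffB a (suc b) d ds e u (d<e ∷ ds<e))
         (cong (λ b → diffB a b 0 (rlCount e)) (sym (ℕₚ.+-suc b (length (lrGo d ds))))))
... | tri≈ _ m≡d _ = contradiction m≡d m≢d
... | tri> _ _ d<m rewrite lrGo-nonrecord ds d<m with u
...   | _ ∷ u′ = trans (guarded-nonrecord (λ e → diffB a b 0 (rlCount e)) ds e d<m)
  (guarded-diffB a b m ds e (m∉ ∷ u′) (m<e ∷ ds<e))

below above : ℕ → List ℕ → ℕ
below r xs = length (filter (_<? r) xs)
above r xs = length (filter (r <?_) xs)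

below-lrGo : ∀ r ds → Unique (r ∷ ds) → below r (r ∷ lrGo r ds) ≡ 0
below-lrGo r ds u = cong length (trans (filter-reject (_<? r) (ℕₚ.<-irrefl refl))
  (filter-none (_<? r) (All.map ℕₚ.<⇒≯ (lrGo-> r ds u))))

above-lrGo : ∀ r ds → Unique (r ∷ ds) → above r (r ∷ lrGo r ds) ≡ length (lrGo r ds)
above-lrGo r ds u = cong length (trans (filter-reject (r <?_) (ℕₚ.<-irrefl refl))
  (filter-all (r <?_) (lrGo-> r ds u)))

below-< : ∀ {r d xs} → d < r → below r (d ∷ xs) ≡ suc (below r xs)
below-< {r} d<r = cong length (filter-accept (_<? r) d<r)

above-< : ∀ {r d xs} → d < r → above r (d ∷ xs) ≡ above r xs
above-< {r} d<r = cong length (filter-reject (r <?_) (ℕₚ.<⇒≯ d<r))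

record-≤ : ∀ {r d} ds → Unique (d ∷ ds) → d ≢ r → r ∈ d ∷ lrGo d ds → d < r × r ∈ lrGo d ds
record-≤ ds u d≢r (here r≡d) = contradiction (sym r≡d) d≢r
record-≤ {d = d} ds u d≢r (there r∈) = All.lookup (lrGo-> d ds u) r∈ , r∈

-- Each maximum before `r` adds one to `s`; at `r` the marks turn into Δ^(s+1) of the powers, and
-- the later maxima raise `b`. The `suc` accounts for the first maximum of π^left, whose push
-- releases `r`.
guarded-marks : ∀ r s m ds e → Unique (m ∷ ds) → All (λ d → All (d <_) e) (m ∷ ds) →
  r ∈ lrGo m ds →
  guarded m (marks r s) ds e ≡
  diffB (suc s ℕ.+ below r (lrGo m ds)) (above r (lrGo m ds)) 0 (rlCount e)
guarded-marks r s m (d ∷ ds) e ((m≢d ∷ m∉) ∷ u) (m<e ∷ d<e ∷ ds<e) r∈ with ℕₚ.<-cmp m d | d ≟ r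
... | tri≈ _ m≡d _ | _ = contradiction m≡d m≢d
... | tri> _ _ d<m | _ rewrite lrGo-nonrecord ds d<m with u
...   | _ ∷ u′ = trans (guarded-nonrecord (marks r s) ds e d<m)
  (guarded-marks r s m ds e (m∉ ∷ u′) (m<e ∷ ds<e) r∈)
guarded-marks r s m (d ∷ ds) e (_ ∷ u) (_ ∷ d<e ∷ ds<e) r∈ | tri< m<d _ _ | yes refl
  rewrite lrGo-record ds m<d | below-lrGo d ds u | above-lrGo d ds u | ℕₚ.+-identityʳ s =
  trans (guarded-record (marks d s) (λ e → diffB (suc s) 0 0 (rlCount e)) ds e m<d (sum-preimages-arrival d s))
        (guarded-diffB (suc s) 0 d ds e u (d<e ∷ ds<e))
guarded-marks r s m (d ∷ ds) e (_ ∷ u) (_ ∷ d<e ∷ ds<e) r∈ | tri< m<d _ _ | no d≢r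
  rewrite lrGo-record ds m<d with record-≤ ds u d≢r r∈
... | d<r , r∈′ rewrite below-< {xs = lrGo d ds} d<r | above-< {xs = lrGo d ds} d<r
                      | ℕₚ.+-suc s (below r (lrGo d ds)) =
  trans (guarded-record (marks r s) (marks r (suc s)) ds e m<d (λ e → sum-preimages-marks r s d e d≢r))
        (guarded-marks r (suc s) d ds e u (d<e ∷ ds<e) r∈′)

StartsWith : ℕ → List ℕ → Set
StartsWith r [] = ⊥
StartsWith r (x ∷ _) = x ≡ r

startsWith? : ∀ r xs → Dec (StartsWith r xs)
startsWith? r [] = no λ ()
startsWith? r (x ∷ _) = x ≟ r

firstChip : ℕ → List ℕ → ℤ
firstChip r xs = branch (startsWith? r xs) 1ℤ 0ℤ

sum-uninsert-exit : ∀ r d e → d ≢ r → Unique e →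
  sumOver (isChip r ∘ proj₁) (uninsert d e) ≡ guard d e (marks r 0 e)
sum-uninsert-exit r d e d≢r u = trans (sum-uninsert _ d e)
  (cong (guard d e) (trans (cong₂ ℤ._+_ (isChip-≢ d≢r) (sum-displace-exit r d e u)) (ℤₚ.+-identityˡ _)))

-- A nonempty T releases a chip of the row, hence one above `r`. The remaining value 1 is written as
-- 1^k to fit `guarded-diffB`.
sum-uninsert-stay : ∀ r e →
  sumOver (isChip r ∘ proj₁) (uninsert r e) ≡ guard r e (diffB 0 0 0 (rlCount e))
sum-uninsert-stay r e = trans (sum-uninsert _ r e) (guard-cong r e (λ r<e → trans
  (cong₂ ℤ._+_ (branch-yes (r ≟ r) refl)
    (sumOver-0 (displace r e) (λ p → isChip-≢ (λ x≡r → <-∉ r<e (subst (_∈ e) x≡r (proj₁ (displace-∈ r e p)))))))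
  (cong +_ (sym (ℕₚ.^-zeroˡ (rlCount e))))))

-- The push with output `d` is undone last and releases the first chip. If d = r then T is empty
-- there; otherwise `r` has to be the last chip of T, which introduces `marks r 0`.
sum-firstChip : ∀ r ds e → Unique (ds ++ e) → All (λ d → All (d <_) e) ds → r ∈ lrMaxima ds →
  sumOver (firstChip r ∘ proj₁) (unsweep ds e) ≡
  diffB (below r (lrMaxima ds)) (above r (lrMaxima ds)) 0 (rlCount e)
sum-firstChip r (d ∷ ds) e u₀ (d<e ∷ ds<e) r∈ = trans
  (sumOver-concatMap (firstChip r ∘ proj₁) (λ s → map (prepend (proj₁ s)) (uninsert d (proj₂ s))) (unsweep ds e))
  (trans (sumOver-cong (unsweep ds e) (λ {s} _ →
      sumOver-map (firstChip r ∘ proj₁) (prepend (proj₁ s)) (uninsert d (proj₂ s))))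
    (cases (d ≟ r)))
  where
  u : Unique (d ∷ ds)
  u = Unique-++ʳ e (Unique-resp-↭ (↭ₚ.++-comm (d ∷ ds) e) u₀)
  u-row : ∀ {s} → s ∈ unsweep ds e → Unique (proj₂ s)
  u-row {xs , zs} p = Unique-++ʳ (d ∷ xs) (Unique-resp-↭
    (↭-prep d (↭-sym (Sweep-↭ (unsweep-sound ds e p)))) u₀)
  cases : Dec (d ≡ r) →
    sumOver (λ s → sumOver (isChip r ∘ proj₁) (uninsert d (proj₂ s))) (unsweep ds e) ≡
    diffB (below r (d ∷ lrGo d ds)) (above r (d ∷ lrGo d ds)) 0 (rlCount e)
  cases (yes refl) rewrite below-lrGo d ds u | above-lrGo d ds u = trans
    (sumOver-cong (unsweep ds e) (λ {s} _ → sum-uninsert-stay d (proj₂ s)))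
    (guarded-diffB 0 0 d ds e u (d<e ∷ ds<e))
  cases (no d≢r) with record-≤ ds u d≢r r∈
  ... | d<r , r∈′ rewrite below-< {xs = lrGo d ds} d<r | above-< {xs = lrGo d ds} d<r = trans
    (sumOver-cong (unsweep ds e) (λ {s} p → sum-uninsert-exit r d (proj₂ s) d≢r (u-row p)))
    (guarded-marks r 0 d ds e u (d<e ∷ ds<e) r∈′)

-- Confluence of toppling

InInterval : ℤ → ℕ → ℤ → Set
InInterval u ℓ z = u ℤ.≤ z × z ℤ.< u ℤ.+ + ℓ

inInterval? : ∀ u ℓ z → Dec (InInterval u ℓ z)
inInterval? u ℓ z = (u ℤ.≤? z) ×-dec (z ℤ.<? u ℤ.+ + ℓ)

bit : ∀ {P : Set} → Dec P → ℕ
bit (yes _) = 1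
bit (no _) = 0

bit≤1 : ∀ {P : Set} (p : Dec P) → bit p ≤ 1
bit≤1 (yes _) = ℕₚ.≤-refl
bit≤1 (no _) = z≤n

bit-yes : ∀ {P : Set} (p : Dec P) → P → bit p ≡ 1
bit-yes (yes _) _ = refl
bit-yes (no ¬p) p = contradiction p ¬p

bit-mono : ∀ {P Q : Set} (p : Dec P) (q : Dec Q) → (P → Q) → bit p ≤ bit q
bit-mono (yes p) q f rewrite bit-yes q (f p) = ℕₚ.≤-refl
bit-mono (no _) q f = z≤n

load : ℤ → ℕ → Config → ℕ
load u ℓ [] = 0
load u ℓ ((_ , z) ∷ c) = bit (inInterval? u ℓ z) ℕ.+ load u ℓ c

load-↭ : ∀ u ℓ {c d} → c ↭ d → load u ℓ c ≡ load u ℓ d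
load-↭ u ℓ ↭.refl = refl
load-↭ u ℓ (↭.prep (_ , z) p) = cong (bit (inInterval? u ℓ z) ℕ.+_) (load-↭ u ℓ p)
load-↭ u ℓ {d = _ ∷ _ ∷ d} (↭.swap (_ , y) (_ , z) p) = trans
  (cong (λ n → bit (inInterval? u ℓ y) ℕ.+ (bit (inInterval? u ℓ z) ℕ.+ n)) (load-↭ u ℓ p))
  (trans (sym (ℕₚ.+-assoc a b _))
    (trans (cong (ℕ._+ load u ℓ d) (ℕₚ.+-comm a b)) (ℕₚ.+-assoc b a _)))
  where
  a = bit (inInterval? u ℓ y)
  b = bit (inInterval? u ℓ z)
load-↭ u ℓ (↭.trans p q) = trans (load-↭ u ℓ p) (load-↭ u ℓ q)

load-mono : ∀ {u ℓ v m} c → (∀ {α z} → (α , z) ∈ c → InInterval u ℓ z → InInterval v m z) →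
  load u ℓ c ≤ load v m c
load-mono [] f = z≤n
load-mono {u} {ℓ} {v} {m} ((_ , z) ∷ c) f = ℕₚ.+-mono-≤
  (bit-mono (inInterval? u ℓ z) (inInterval? v m z) (f (here refl)))
  (load-mono c (f ∘ there))

-- At most two chips per site is not preserved by itself, but this strengthening to intervals is.
Sparse : Config → Set
Sparse c = ∀ u ℓ → load u ℓ c ≤ suc ℓ

-1≡pred : ∀ s → s ℤ.- 1ℤ ≡ ℤ.pred s
-1≡pred s = ℤₚ.+-comm s -1ℤ

+1≡suc : ∀ s → s ℤ.+ 1ℤ ≡ ℤ.suc s
+1≡suc s = ℤₚ.+-comm s 1ℤ

<suc : ∀ {a b} → a ℤ.≤ b → a ℤ.< ℤ.suc b
<suc a≤b = ℤₚ.suc[i]≤j⇒i<j (ℤₚ.suc-mono a≤b)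

pred-widen : ∀ u ℓ → ℤ.pred u ℤ.+ + suc ℓ ≡ u ℤ.+ + ℓ
pred-widen u ℓ = ring u (+ ℓ)
  where
  ring : ∀ u l → (-1ℤ ℤ.+ u) ℤ.+ (1ℤ ℤ.+ l) ≡ u ℤ.+ l
  ring = solve-∀

suc-widen : ∀ u ℓ → u ℤ.+ + suc ℓ ≡ ℤ.suc (u ℤ.+ + ℓ)
suc-widen u ℓ = ring u (+ ℓ)
  where
  ring : ∀ u l → u ℤ.+ (1ℤ ℤ.+ l) ≡ 1ℤ ℤ.+ (u ℤ.+ l)
  ring = solve-∀

Extension : ℤ → ℕ → ℤ → Set
Extension u ℓ s = Σ ℤ λ v → InInterval v (suc ℓ) s × (∀ {z} → InInterval u ℓ z → InInterval v (suc ℓ) z)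

extendʳ : ∀ {u ℓ} s → InInterval u ℓ (s ℤ.- 1ℤ) → Extension u ℓ s
extendʳ {u} {ℓ} s (u≤ , <u+ℓ) = u ,
  (ℤₚ.≤-trans u≤ (ℤₚ.i≤j⇒i-k≤j 1ℤ ℤₚ.≤-refl) ,
   subst (s ℤ.<_) (sym (suc-widen u ℓ))
     (<suc (subst (ℤ._≤ u ℤ.+ + ℓ) (trans (cong ℤ.suc (-1≡pred s)) (ℤₚ.suc-pred s)) (ℤₚ.i<j⇒suc[i]≤j <u+ℓ)))) ,
  λ { (u≤z , z<) → u≤z , subst (_ ℤ.<_) (sym (suc-widen u ℓ)) (<suc (ℤₚ.<⇒≤ z<)) }

extendˡ : ∀ {u ℓ} s → InInterval u ℓ (s ℤ.+ 1ℤ) → Extension u ℓ s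
extendˡ {u} {ℓ} s (u≤ , <u+ℓ) = ℤ.pred u ,
  (subst (ℤ.pred u ℤ.≤_) (trans (cong ℤ.pred (+1≡suc s)) (ℤₚ.pred-suc s)) (ℤₚ.pred-mono u≤) ,
   subst (s ℤ.<_) (sym (pred-widen u ℓ))
     (ℤₚ.<-trans (subst (s ℤ.<_) (sym (+1≡suc s)) (<suc ℤₚ.≤-refl)) <u+ℓ)) ,
  λ { (u≤z , z<) → ℤₚ.i≤j⇒pred[i]≤j u≤z , subst (_ ℤ.<_) (sym (pred-widen u ℓ)) z< }

between : ∀ {u ℓ} s → InInterval u ℓ (s ℤ.- 1ℤ) → InInterval u ℓ (s ℤ.+ 1ℤ) → InInterval u ℓ s
between {u} {ℓ} s (u≤ , _) (_ , <u+ℓ) =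
  ℤₚ.≤-trans u≤ (ℤₚ.i≤j⇒i-k≤j 1ℤ ℤₚ.≤-refl) ,
  ℤₚ.<-trans (subst (s ℤ.<_) (sym (+1≡suc s)) (<suc ℤₚ.≤-refl)) <u+ℓ

-- If `s` is in the interval, it held both fired chips before and holds at most two after. Otherwise
-- at most one enters, by convexity; if one does, the interval extended by `s` held both fired
-- chips, which leaves at most ℓ others.
Step-sparse : ∀ {c d} → Sparse c → Step c d → Sparse d
Step-sparse {c} {d} sparse (α , β , s , R , _ , c↭ , d↭) u ℓ =
  subst (_≤ suc ℓ) (sym (load-↭ u ℓ d↭)) (cases a? b? c?)
  where
  a? = inInterval? u ℓ (s ℤ.- 1ℤ)
  b? = inInterval? u ℓ s
  c? = inInterval? u ℓ (s ℤ.+ 1ℤ)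
  r = load u ℓ R
  bound : ∀ v m → bit (inInterval? v m s) ℕ.+ (bit (inInterval? v m s) ℕ.+ load v m R) ≤ suc m
  bound v m = subst (_≤ suc m) (load-↭ v m c↭) (sparse v m)
  extended : Extension u ℓ s → r ≤ ℓ
  extended (v , s∈ , ⊆) = ℕₚ.≤-trans (load-mono R (λ _ → ⊆)) (ℕ.s≤s⁻¹ (ℕ.s≤s⁻¹
    (subst (λ b → b ℕ.+ (b ℕ.+ load v (suc ℓ) R) ≤ suc (suc ℓ)) (bit-yes (inInterval? v (suc ℓ) s) s∈)
           (bound v (suc ℓ)))))
  cases : (a : Dec (InInterval u ℓ (s ℤ.- 1ℤ))) (b : Dec (InInterval u ℓ s))
          (c : Dec (InInterval u ℓ (s ℤ.+ 1ℤ))) → bit a ℕ.+ (bit c ℕ.+ r) ≤ suc ℓ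
  cases a (yes p) c = ℕₚ.≤-trans (ℕₚ.+-mono-≤ (bit≤1 a) (ℕₚ.+-monoˡ-≤ r (bit≤1 c)))
    (subst (λ b → b ℕ.+ (b ℕ.+ r) ≤ suc ℓ) (bit-yes (inInterval? u ℓ s) p) (bound u ℓ))
  cases (yes a) (no ¬b) (yes c) = contradiction (between s a c) ¬b
  cases (yes a) (no _) (no _) = s≤s (extended (extendʳ s a))
  cases (no _) (no _) (yes c) = s≤s (extended (extendˡ s c))
  cases (no _) (no _) (no _) =
    ℕₚ.≤-trans (ℕₚ.m≤n+m r _) (ℕₚ.≤-trans (ℕₚ.m≤n+m _ (bit b?)) (bound u ℓ))

at-site : ∀ s → InInterval s 1 s
at-site s = ℤₚ.≤-refl , subst (s ℤ.<_) (sym (+1≡suc s)) (<suc ℤₚ.≤-refl)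

load-∈ : ∀ {γ s} c → (γ , s) ∈ c → 1 ≤ load s 1 c
load-∈ {s = s} (_ ∷ c) (here refl) rewrite bit-yes (inInterval? s 1 s) (at-site s) = s≤s z≤n
load-∈ (_ ∷ c) (there p) = ℕₚ.≤-trans (load-∈ c p) (ℕₚ.m≤n+m _ _)

at-most-two : ∀ {c α β γ s R} → Sparse c → c ↭ (α , s) ∷ (β , s) ∷ R → (γ , s) ∉ R
at-most-two {s = s} {R} sparse c↭ γ∈ = ℕₚ.<⇒≱ (s≤s (s≤s (load-∈ R γ∈)))
  (subst (λ b → b ℕ.+ (b ℕ.+ load s 1 R) ≤ 2) (bit-yes (inInterval? s 1 s) (at-site s))
    (subst (_≤ 2) (load-↭ s 1 c↭) (sparse s 1)))

∈-↭-∷ : ∀ {A : Set} {x : A} {xs} → x ∈ xs → ∃ λ ys → xs ↭ x ∷ ys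
∈-↭-∷ x∈ with ∈ₚ.∈-∃++ x∈
... | ys , zs , refl = ys ++ zs , ↭ₚ.shift _ ys zs

∈-pair⁻ : ∀ {A : Set} {x y z : A} {xs} → x ∈ y ∷ z ∷ xs → x ≢ y → x ≢ z → x ∈ xs
∈-pair⁻ (here x≡y) x≢y _ = contradiction x≡y x≢y
∈-pair⁻ (there (here x≡z)) _ x≢z = contradiction x≡z x≢z
∈-pair⁻ (there (there x∈)) _ _ = x∈

same-site : ∀ {c α β γ s R} → Sparse c → c ↭ (α , s) ∷ (β , s) ∷ R →
  (γ , s) ∈ (α , s) ∷ (β , s) ∷ R → γ ≡ α ⊎ γ ≡ β
same-site sparse c↭ (here refl) = inj₁ refl
same-site sparse c↭ (there (here refl)) = inj₂ refl
same-site sparse c↭ (there (there γ∈)) = contradiction γ∈ (at-most-two sparse c↭)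

-- A site holds at most two chips, so firings at the same site agree; firings at different sites
-- move disjoint pairs and commute.
diamond : ∀ {c d₁ d₂} → Sparse c → Step c d₁ → Step c d₂ →
  d₁ ↭ d₂ ⊎ ∃ λ e → Step d₁ e × Step d₂ e
diamond {c} {d₁} {d₂} sparse (α , β , s , R , α<β , c↭ , d₁↭) (α′ , β′ , s′ , R′ , α′<β′ , c↭′ , d₂↭)
  with s ℤ.≟ s′
... | yes refl = inj₁ (coincide (same-site sparse c↭ α′∈) (same-site sparse c↭ β′∈))
  where
  both : (α , s) ∷ (β , s) ∷ R ↭ (α′ , s) ∷ (β′ , s) ∷ R′
  both = ↭-trans (↭-sym c↭) c↭′
  α′∈ : (α′ , s) ∈ (α , s) ∷ (β , s) ∷ R
  α′∈ = ↭ₚ.∈-resp-↭ (↭-sym both) (here refl)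
  β′∈ : (β′ , s) ∈ (α , s) ∷ (β , s) ∷ R
  β′∈ = ↭ₚ.∈-resp-↭ (↭-sym both) (there (here refl))
  coincide : α′ ≡ α ⊎ α′ ≡ β → β′ ≡ α ⊎ β′ ≡ β → d₁ ↭ d₂
  coincide (inj₁ refl) (inj₁ refl) = contradiction α′<β′ (ℕₚ.<-irrefl refl)
  coincide (inj₁ refl) (inj₂ refl) =
    ↭-trans d₁↭ (↭-trans (↭-prep _ (↭-prep _ (↭ₚ.drop-∷ (↭ₚ.drop-∷ both)))) (↭-sym d₂↭))
  coincide (inj₂ refl) (inj₁ refl) = contradiction α<β (ℕₚ.<-asym α′<β′)
  coincide (inj₂ refl) (inj₂ refl) = contradiction α′<β′ (ℕₚ.<-irrefl refl)
... | no s≢s′ = inj₂ (commute (∈-↭-∷ α′∈))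
  where
  other : ∀ {γ δ} → (γ , s′) ≢ (δ , s)
  other refl = s≢s′ refl
  both : (α , s) ∷ (β , s) ∷ R ↭ (α′ , s′) ∷ (β′ , s′) ∷ R′
  both = ↭-trans (↭-sym c↭) c↭′
  α′∈ : (α′ , s′) ∈ R
  α′∈ = ∈-pair⁻ (↭ₚ.∈-resp-↭ (↭-sym both) (here refl)) other other
  commute : (∃ λ R₁ → R ↭ (α′ , s′) ∷ R₁) → ∃ λ e → Step d₁ e × Step d₂ e
  commute (R₁ , R↭) = finish (∈-↭-∷ β′∈)
    where
    without-α′ : (α , s) ∷ (β , s) ∷ R₁ ↭ (β′ , s′) ∷ R′
    without-α′ = ↭ₚ.drop-∷ (↭-trans
      (↭-sym (↭-trans (↭-prep _ (↭-prep _ R↭)) (↭ₚ.shift (α′ , s′) ((α , s) ∷ (β , s) ∷ []) R₁))) both)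
    β′∈ : (β′ , s′) ∈ R₁
    β′∈ = ∈-pair⁻ (↭ₚ.∈-resp-↭ (↭-sym without-α′) (here refl)) other other
    finish : (∃ λ R₂ → R₁ ↭ (β′ , s′) ∷ R₂) → ∃ λ e → Step d₁ e × Step d₂ e
    finish (R₂ , R₁↭) = fired ++ fired′ ++ R₂ ,
      (α′ , β′ , s′ , fired ++ R₂ , α′<β′ ,
       ↭-trans d₁↭ (↭-trans (↭ₚ.++⁺ˡ fired (↭-trans R↭ (↭-prep _ R₁↭))) (↭ₚ.shifts fired pair′)) ,
       ↭ₚ.shifts fired fired′) ,
      (α , β , s , fired′ ++ R₂ , α<β ,
       ↭-trans d₂↭ (↭-trans (↭ₚ.++⁺ˡ fired′ R′↭) (↭ₚ.shifts fired′ pair)) ,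
       ↭-refl)
      where
      pair pair′ fired fired′ : Config
      pair = (α , s) ∷ (β , s) ∷ []
      pair′ = (α′ , s′) ∷ (β′ , s′) ∷ []
      fired = (α , s ℤ.- 1ℤ) ∷ (β , s ℤ.+ 1ℤ) ∷ []
      fired′ = (α′ , s′ ℤ.- 1ℤ) ∷ (β′ , s′ ℤ.+ 1ℤ) ∷ []
      R′↭ : R′ ↭ pair ++ R₂
      R′↭ = ↭-sym (↭ₚ.drop-∷ (↭-trans
        (↭-sym (↭-trans (↭-prep _ (↭-prep _ R₁↭)) (↭ₚ.shift (β′ , s′) pair R₂))) without-α′))

∈-zip⁻ : ∀ {α : ℕ} {s : ℤ} π ss → (α , s) ∈ zip π ss → s ∈ ss
∈-zip⁻ (_ ∷ π) (_ ∷ ss) (here refl) = here refl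
∈-zip⁻ (_ ∷ π) (_ ∷ ss) (there p) = there (∈-zip⁻ π ss p)

zip-functional : ∀ {α β : ℕ} {s} π {ss} → AllPairs ℤ._<_ ss →
  (α , s) ∈ zip π ss → (β , s) ∈ zip π ss → α ≡ β
zip-functional (_ ∷ π) (_ ∷ _) (here refl) (here refl) = refl
zip-functional (_ ∷ π) {_ ∷ ss} (s< ∷ _) (here refl) (there q) =
  contradiction (All.lookup s< (∈-zip⁻ π ss q)) (ℤₚ.<-irrefl refl)
zip-functional (_ ∷ π) {_ ∷ ss} (s< ∷ _) (there p) (here refl) =
  contradiction (All.lookup s< (∈-zip⁻ π ss p)) (ℤₚ.<-irrefl refl)
zip-functional (_ ∷ π) (_ ∷ o) (there p) (there q) = zip-functional π o p q

sorted : ∀ {ss} → Linked ℤ._<_ ss → AllPairs ℤ._<_ ss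
sorted = Linked⇒AllPairs ℤₚ.<-trans

ReadsAs-stable : ∀ {c d π} → ReadsAs c π → ¬ Step c d
ReadsAs-stable {π = π} (ss , linked , _ , c↭) (α , β , s , R , α<β , c↭′ , _) =
  ℕₚ.<-irrefl (zip-functional π (sorted linked)
    (↭ₚ.∈-resp-↭ c↭ (↭ₚ.∈-resp-↭ (↭-sym c↭′) (here refl)))
    (↭ₚ.∈-resp-↭ c↭ (↭ₚ.∈-resp-↭ (↭-sym c↭′) (there (here refl))))) α<β

-- If the leftmost entries differed, each would occur later in the other list, making each of the
-- two leftmost sites larger than the other.
zip-↭-unique : ∀ {ss ss′} (π π′ : List ℕ) → AllPairs ℤ._<_ ss → AllPairs ℤ._<_ ss′ →
  length ss ≡ length π → length ss′ ≡ length π′ → zip π ss ↭ zip π′ ss′ → π ≡ π′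
zip-↭-unique {[]} {[]} [] [] _ _ _ _ _ = refl
zip-↭-unique {[]} {_ ∷ _} [] (_ ∷ _) _ _ _ _ p = contradiction (↭-sym p) ↭ₚ.¬x∷xs↭[]
zip-↭-unique {_ ∷ _} {[]} (_ ∷ _) [] _ _ _ _ p = contradiction p ↭ₚ.¬x∷xs↭[]
zip-↭-unique {s ∷ ss} {s′ ∷ ss′} (α ∷ π) (β ∷ π′) (s< ∷ o) (s′< ∷ o′) l l′ p
  with ↭ₚ.∈-resp-↭ p (here refl) | ↭ₚ.∈-resp-↭ (↭-sym p) (here refl)
... | here refl | _ = cong (α ∷_)
  (zip-↭-unique π π′ o o′ (ℕₚ.suc-injective l) (ℕₚ.suc-injective l′) (↭ₚ.drop-∷ p))
... | there _ | here refl = cong (α ∷_)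
  (zip-↭-unique π π′ o o′ (ℕₚ.suc-injective l) (ℕₚ.suc-injective l′) (↭ₚ.drop-∷ p))
... | there q | there q′ = contradiction (All.lookup s< (∈-zip⁻ π ss q′))
  (ℤₚ.<-asym (All.lookup s′< (∈-zip⁻ π′ ss′ q)))

ReadsAs-unique : ∀ {c π π′} → ReadsAs c π → ReadsAs c π′ → π ≡ π′
ReadsAs-unique {π = π} {π′} (_ , linked , len , c↭) (_ , linked′ , len′ , c↭′) =
  zip-↭-unique π π′ (sorted linked) (sorted linked′) len len′ (↭-trans (↭-sym c↭) c↭′)

TopplesTo-resp-↭ : ∀ {c d π} → c ↭ d → TopplesTo d π → TopplesTo c π
TopplesTo-resp-↭ c↭d (d , ε , ss , linked , len , d↭) = _ , ε , ss , linked , len , ↭-trans c↭d d↭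
TopplesTo-resp-↭ c↭d (d′ , (α , β , s , R , α<β , d↭ , e↭) ◅ steps , reads) =
  d′ , (α , β , s , R , α<β , ↭-trans c↭d d↭ , e↭) ◅ steps , reads

TopplesTo-step : ∀ {c d π} → Step c d → TopplesTo d π → TopplesTo c π
TopplesTo-step st (d′ , steps , reads) = d′ , st ◅ steps , reads

-- The diamond carries the extra step along the given toppling sequence until it coincides with one
-- of its steps; it cannot survive to the end, where no step is possible.
TopplesTo-after-step : ∀ {c d π} → Sparse c → Step c d → TopplesTo c π → TopplesTo d π
TopplesTo-after-step sparse st (_ , steps , reads) = go sparse st steps reads
  where
  go : ∀ {c d c′ π} → Sparse c → Step c d → Star Step c c′ → ReadsAs c′ π → TopplesTo d π
  go sparse st ε reads = contradiction st (ReadsAs-stable reads)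
  go sparse st (st′ ◅ steps) reads with diamond sparse st st′
  ... | inj₁ d↭ = TopplesTo-resp-↭ d↭ (_ , steps , reads)
  ... | inj₂ (e , d→e , c₁→e) =
    TopplesTo-step d→e (go (Step-sparse sparse st′) c₁→e steps reads)

infix 4 _⇝_
-- Unlike `Star Step`, this allows a rearrangement of the list even when no step is made.
data _⇝_ : Config → Config → Set where
  perm : ∀ {c d} → c ↭ d → c ⇝ d
  step : ∀ {c c′ d} → Step c c′ → c′ ⇝ d → c ⇝ d

⇝-resp-↭ : ∀ {c d e} → c ↭ d → d ⇝ e → c ⇝ e
⇝-resp-↭ c↭d (perm d↭e) = perm (↭-trans c↭d d↭e)
⇝-resp-↭ c↭d (step (α , β , s , R , α<β , d↭ , d′↭) r) =
  step (α , β , s , R , α<β , ↭-trans c↭d d↭ , d′↭) r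

⇝-trans : ∀ {c d e} → c ⇝ d → d ⇝ e → c ⇝ e
⇝-trans (perm c↭d) r = ⇝-resp-↭ c↭d r
⇝-trans (step st q) r = step st (⇝-trans q r)

TopplesTo-⇝ : ∀ {c d π} → c ⇝ d → TopplesTo d π → TopplesTo c π
TopplesTo-⇝ (perm c↭d) t = TopplesTo-resp-↭ c↭d t
TopplesTo-⇝ (step st r) t = TopplesTo-step st (TopplesTo-⇝ r t)

TopplesTo-after : ∀ {c d π} → Sparse c → c ⇝ d → TopplesTo c π → TopplesTo d π
TopplesTo-after sparse (perm c↭d) t = TopplesTo-resp-↭ (↭-sym c↭d) t
TopplesTo-after sparse (step st r) t =
  TopplesTo-after (Step-sparse sparse st) r (TopplesTo-after-step sparse st t)

TopplesTo-ReadsAs : ∀ {c π π′} → TopplesTo c π → ReadsAs c π′ → π ≡ π′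
TopplesTo-ReadsAs (_ , ε , reads) reads′ = ReadsAs-unique reads reads′
TopplesTo-ReadsAs (_ , st ◅ _ , _) reads′ = contradiction st (ReadsAs-stable reads′)

-- Sweeps as a toppling order

place : ℕ → List ℕ → Config
place s [] = []
place s (y ∷ ys) = (y , + s) ∷ place (suc s) ys

place-++ : ∀ s xs ys → place s (xs ++ ys) ≡ place s xs ++ place (s ℕ.+ length xs) ys
place-++ s [] ys = cong (λ k → place k ys) (sym (ℕₚ.+-identityʳ s))
place-++ s (x ∷ xs) ys = cong ((x , + s) ∷_)
  (trans (place-++ (suc s) xs ys)
         (cong (λ k → place (suc s) xs ++ place k ys) (sym (ℕₚ.+-suc s (length xs)))))

place-≥ : ∀ {α z} s ys → (α , z) ∈ place s ys → + s ℤ.≤ z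
place-≥ s (y ∷ ys) (here refl) = ℤₚ.≤-refl
place-≥ s (y ∷ ys) (there p) = ℤₚ.≤-trans (ℤ.+≤+ (ℕₚ.n≤1+n s)) (place-≥ (suc s) ys p)

load-place : ∀ u ℓ s ys → load u ℓ (place s ys) ≤ ℓ
load-place u ℓ s [] = z≤n
load-place u ℓ s (y ∷ ys) with inInterval? u ℓ (+ s)
... | no _ = load-place u ℓ (suc s) ys
load-place u zero s (y ∷ ys) | yes (u≤s , s<u) =
  contradiction (ℤₚ.<-≤-trans s<u (subst (ℤ._≤ + s) (sym (ℤₚ.+-identityʳ u)) u≤s)) (ℤₚ.<-irrefl refl)
load-place u (suc ℓ) s (y ∷ ys) | yes (u≤s , _) = s≤s (ℕₚ.≤-trans
  (load-mono (place (suc s) ys) (λ p → λ { (_ , z<) →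
    ℤₚ.≤-trans (ℤₚ.suc-mono u≤s) (place-≥ (suc s) ys p) ,
    subst (_ ℤ.<_) (trans (suc-widen u ℓ) (sym (ℤₚ.+-assoc 1ℤ u (+ ℓ)))) z< }))
  (load-place (ℤ.suc u) ℓ (suc s) ys))

initial-sparse : ∀ x p w → Sparse ((x , + p) ∷ place 1 w)
initial-sparse x p w u ℓ = ℕₚ.+-mono-≤ (bit≤1 (inInterval? u ℓ (+ p))) (load-place u ℓ 1 w)

zip-sites : ∀ (f : ℕ → ℕ) s w → (∀ i → suc (f i) ≡ s ℕ.+ i) →
  zip w (map +_ (map suc (applyUpTo f (length w)))) ≡ place s w
zip-sites f s [] eq = refl
zip-sites f s (y ∷ ys) eq = cong₂ _∷_
  (cong (λ k → y , + k) (trans (eq 0) (ℕₚ.+-identityʳ s)))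
  (zip-sites (f ∘ suc) (suc s) ys (λ i → trans (eq (suc i)) (ℕₚ.+-suc s i)))

initConfig≡ : ∀ w x p → initConfig w x p ≡ (x , + p) ∷ place 1 w
initConfig≡ w x p = cong ((x , + p) ∷_) (zip-sites (λ i → i) 1 w (λ i → refl))

site-suc : ∀ s → + suc s ℤ.+ 1ℤ ≡ + suc (suc s)
site-suc s = cong +_ (ℕₚ.+-comm (suc s) 1)

fire : ∀ {α β} s R → α < β →
  Step ((α , + suc s) ∷ (β , + suc s) ∷ R) ((α , + s) ∷ (β , + suc (suc s)) ∷ R)
fire {α} {β} s R α<β = α , β , + suc s , R , α<β , ↭-refl ,
  ↭-reflexive (cong (λ z → (α , + s) ∷ (β , z) ∷ R) (sym (site-suc s)))

-- The firings run from the right end of the row to its left end. Each larger chip moves one site to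
-- the right, so the whole row shifts by one and site s + 1 becomes empty.
Insert-⇝ : ∀ {x e d e′} → Insert x e d e′ → ∀ s R →
  (x , + (s ℕ.+ length e)) ∷ place (suc s) e ++ R ⇝ (d , + s) ∷ place (suc (suc s)) e′ ++ R
Insert-⇝ {x} done s R = perm (↭-reflexive (cong (λ k → (x , + k) ∷ R) (ℕₚ.+-identityʳ s)))
Insert-⇝ {x} (keep {y = y} {m} {ys} {zs} i m<y) s R rewrite ℕₚ.+-suc s (length ys) =
  ⇝-resp-↭ (↭-prep _ (↭-sym (↭ₚ.shift (y , + suc s) (place (suc (suc s)) ys) R)))
  (⇝-trans (Insert-⇝ i (suc s) ((y , + suc s) ∷ R))
  (⇝-resp-↭ (↭-prep _ (↭ₚ.shift (y , + suc s) (place (suc (suc (suc s))) zs) R))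
  (step (fire s _ m<y) (perm ↭-refl))))
Insert-⇝ {x} (swap {y = y} {m} {ys} {zs} i y<m) s R rewrite ℕₚ.+-suc s (length ys) =
  ⇝-resp-↭ (↭-prep _ (↭-sym (↭ₚ.shift (y , + suc s) (place (suc (suc s)) ys) R)))
  (⇝-trans (Insert-⇝ i (suc s) ((y , + suc s) ∷ R))
  (⇝-resp-↭ (↭-trans (↭-prep _ (↭ₚ.shift (y , + suc s) (place (suc (suc (suc s))) zs) R))
                     (↭-swap _ _ ↭-refl))
  (step (fire s _ y<m) (perm ↭-refl))))

-- The shifted row ends on the site of the next chip of `xs`, which starts the next insertion. The
-- empty site finally separates `ds` from `e′`.
Sweep-⇝ : ∀ {xs e ds e′} → Sweep xs e ds e′ → ∀ s R →
  place (s ℕ.+ length e) xs ++ place (suc s) e ++ R ⇝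
  place s ds ++ place (suc (s ℕ.+ length ds)) e′ ++ R
Sweep-⇝ {e = e} [] s R =
  perm (↭-reflexive (cong (λ k → place (suc k) e ++ R) (sym (ℕₚ.+-identityʳ s))))
Sweep-⇝ (_∷_ {x} {xs} {d} {ds} {e} {e₁} {e″} i sw) s R =
  ⇝-resp-↭ (↭-prep _ (↭ₚ.shifts (place (suc (s ℕ.+ length e)) xs) (place (suc s) e)))
  (⇝-trans (Insert-⇝ i s (place (suc (s ℕ.+ length e)) xs ++ R))
  (⇝-resp-↭ regroup
  (⇝-trans (Sweep-⇝ sw (suc s) ((d , + s) ∷ R)) (perm collect))))
  where
  regroup : (d , + s) ∷ place (suc (suc s)) e₁ ++ place (suc (s ℕ.+ length e)) xs ++ R ↭
            place (suc s ℕ.+ length e₁) xs ++ place (suc (suc s)) e₁ ++ (d , + s) ∷ R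
  regroup rewrite Insert-length i = ↭-trans
    (↭-prep _ (↭ₚ.shifts (place (suc (suc s)) e₁) (place (suc (s ℕ.+ length e₁)) xs)))
    (↭-trans (↭-sym (↭ₚ.shift (d , + s) (place (suc (s ℕ.+ length e₁)) xs) _))
      (↭ₚ.++⁺ˡ (place (suc (s ℕ.+ length e₁)) xs)
        (↭-sym (↭ₚ.shift (d , + s) (place (suc (suc s)) e₁) R))))
  collect : place (suc s) ds ++ place (suc (suc s ℕ.+ length ds)) e″ ++ (d , + s) ∷ R ↭
            (d , + s) ∷ place (suc s) ds ++ place (suc (s ℕ.+ suc (length ds))) e″ ++ R
  collect rewrite ℕₚ.+-suc s (length ds) = ↭-trans
    (↭ₚ.++⁺ˡ (place (suc s) ds) (↭ₚ.shift (d , + s) (place (suc (suc (s ℕ.+ length ds))) e″) R))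
    (↭ₚ.shift (d , + s) (place (suc s) ds) _)

run : ℕ → ℕ → List ℤ
run s zero = []
run s (suc n) = + s ∷ run (suc s) n

length-run : ∀ s n → length (run s n) ≡ n
length-run s zero = refl
length-run s (suc n) = cong suc (length-run (suc s) n)

run-linked : ∀ s n → Linked ℤ._<_ (run s n)
run-linked s zero = []
run-linked s (suc zero) = [-]
run-linked s (suc (suc n)) = ℤ.+<+ (ℕₚ.n<1+n s) ∷ run-linked (suc s) (suc n)

runs-linked : ∀ s n t m → s ℕ.+ n ≤ t → Linked ℤ._<_ (run s n ++ run t m)
runs-linked s zero t m _ = run-linked t m
runs-linked s (suc zero) t zero _ = [-]
runs-linked s (suc zero) t (suc m) s<t =
  ℤ.+<+ (subst (_≤ t) (ℕₚ.+-comm s 1) s<t) ∷ run-linked t (suc m)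
runs-linked s (suc (suc n)) t m ≤t =
  ℤ.+<+ (ℕₚ.n<1+n s) ∷ runs-linked (suc s) (suc n) t m (subst (_≤ t) (ℕₚ.+-suc s (suc n)) ≤t)

zip-run : ∀ s ys → zip ys (run s (length ys)) ≡ place s ys
zip-run s [] = refl
zip-run s (y ∷ ys) = cong ((y , + s) ∷_) (zip-run (suc s) ys)

zip-runs : ∀ s xs t ys →
  zip (xs ++ ys) (run s (length xs) ++ run t (length ys)) ≡ place s xs ++ place t ys
zip-runs s [] t ys = zip-run t ys
zip-runs s (x ∷ xs) t ys = cong ((x , + s) ∷_) (zip-runs (suc s) xs t ys)

ReadsAs-place : ∀ ds e → ReadsAs (place 0 ds ++ place (suc (length ds)) e ++ []) (ds ++ e)
ReadsAs-place ds e = run 0 (length ds) ++ run (suc (length ds)) (length e) ,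
  runs-linked 0 (length ds) _ (length e) (ℕₚ.n≤1+n _) ,
  trans (length-++ (run 0 (length ds)))
    (trans (cong₂ ℕ._+_ (length-run 0 (length ds)) (length-run _ (length e))) (sym (length-++ ds))) ,
  ↭-reflexive (trans (cong (place 0 ds ++_) (++-identityʳ _))
    (sym (zip-runs 0 ds (suc (length ds)) e)))

initConfig-⇝ : ∀ {x xs e ds e′} → Sweep (x ∷ xs) e ds e′ →
  initConfig (e ++ xs) x (length e) ⇝ place 0 ds ++ place (suc (length ds)) e′ ++ []
initConfig-⇝ {x} {xs} {e} sw = ⇝-resp-↭
  (↭-trans (↭-reflexive (trans (initConfig≡ (e ++ xs) x (length e))
      (cong ((x , + length e) ∷_) (place-++ 1 e xs))))
    (↭-prep _ (↭-trans (↭ₚ.++-comm (place 1 e) _)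
      (↭-reflexive (cong (place (suc (length e)) xs ++_) (sym (++-identityʳ (place 1 e))))))))
  (Sweep-⇝ sw 0 [])

Sweep⇒TopplesTo : ∀ {x xs e ds e′} → Sweep (x ∷ xs) e ds e′ →
  TopplesTo (initConfig (e ++ xs) x (length e)) (ds ++ e′)
Sweep⇒TopplesTo {ds = ds} {e′} sw =
  TopplesTo-⇝ (initConfig-⇝ sw) (_ , ε , ReadsAs-place ds e′)

-- The sweep is one way of toppling, and by confluence every other way ends in the same reading.
TopplesTo⇒Sweep : ∀ {x xs e π} → Unique (x ∷ xs ++ e) →
  TopplesTo (initConfig (e ++ xs) x (length e)) π →
  ∃₂ λ ds e′ → Sweep (x ∷ xs) e ds e′ × π ≡ ds ++ e′
TopplesTo⇒Sweep {x} {xs} {e} u t with Sweep-total (x ∷ xs) e u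
... | ds , e′ , sw = ds , e′ , sw , TopplesTo-ReadsAs
  (TopplesTo-after (subst Sparse (sym (initConfig≡ (e ++ xs) x (length e)))
                     (initial-sparse x (length e) (e ++ xs)))
                   (initConfig-⇝ sw) t)
  (ReadsAs-place ds e′)

-- Preimages of a permutation

Insert-All : ∀ {c x e d e′} → Insert x e d e′ → All (c <_) e → All (c <_) e′
Insert-All done [] = []
Insert-All (keep i _) (c<y ∷ c<ys) = c<y ∷ Insert-All i c<ys
Insert-All (swap i y<m) (c<y ∷ c<ys) = ℕₚ.<-trans c<y y<m ∷ Insert-All i c<ys

Sweep-All : ∀ {c xs e ds e′} → Sweep xs e ds e′ → All (c <_) e → All (c <_) e′
Sweep-All [] p = p
Sweep-All (i ∷ sw) p = Sweep-All sw (Insert-All i p)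

-- An output is below the row it leaves, and later insertions only replace row entries by larger
-- ones.
Sweep-separated : ∀ {xs e ds e′} → Sweep xs e ds e′ → All (λ d → All (d <_) e′) ds
Sweep-separated [] = []
Sweep-separated (i ∷ sw) = Sweep-All sw (Insert-minimum i) ∷ Sweep-separated sw

range-suc : ∀ m → range (suc m) ↭ suc m ∷ range m
range-suc m = ↭-trans
  (↭-reflexive (trans (cong (map suc) (sym (upTo-∷ʳ m))) (map-++ suc (upTo m) (m ∷ []))))
  (↭-sym (↭ₚ.∷↭∷ʳ (suc m) (range m)))

length-range : ∀ m → length (range m) ≡ m
length-range m = trans (length-map suc (upTo m)) (length-upTo m)

range-unique : ∀ m → Unique (range m)
range-unique m = Uniqueₚ.map⁺ ℕₚ.suc-injective (Uniqueₚ.upTo⁺ m)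

shift-< : ∀ {r x} → x < r → shift r x ≡ x
shift-< {r} {x} x<r with x <? r
... | yes _ = refl
... | no x≮r = contradiction x<r x≮r

shift-≥ : ∀ {r x} → r ≤ x → shift r x ≡ suc x
shift-≥ {r} {x} r≤x with x <? r
... | yes x<r = contradiction x<r (ℕₚ.≤⇒≯ r≤x)
... | no _ = refl

range-≤ : ∀ m → All (_≤ m) (range m)
range-≤ m = Allₚ.map⁺ (Allₚ.applyUpTo⁺₁ (λ i → i) m (λ i<m → i<m))

range-shift : ∀ m r → 1 ≤ r → r ≤ suc m → r ∷ map (shift r) (range m) ↭ range (suc m)
range-shift m r 1≤r r≤1+m with ℕₚ.m≤n⇒m<n∨m≡n r≤1+m
... | inj₂ refl = ↭-trans
  (↭-reflexive (cong (suc m ∷_) (map-id-local (All.map (λ x≤m → shift-< (s≤s x≤m)) (range-≤ m)))))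
  (↭-sym (range-suc m))
range-shift zero (suc r) 1≤r _ | inj₁ (s≤s ())
range-shift (suc m) r 1≤r _ | inj₁ (s≤s r≤1+m) = ↭-trans
  (↭-prep r (↭ₚ.map⁺ (shift r) (range-suc m)))
  (↭-trans (↭-swap r _ ↭-refl)
  (↭-trans (↭-prep _ (range-shift m r 1≤r r≤1+m))
  (↭-trans (↭-reflexive (cong (_∷ range (suc m)) (shift-≥ r≤1+m)))
           (↭-sym (range-suc (suc m))))))

unshift : ℕ → ℕ → ℕ
unshift r x = branch (x <? r) x (ℕ.pred x)

unshift-shift : ∀ r x → unshift r (shift r x) ≡ x
unshift-shift r x with x <? r
... | yes x<r = branch-yes (x <? r) x<r
... | no x≮r = branch-no (suc x <? r) (λ sx<r → x≮r (ℕₚ.<-trans (ℕₚ.n<1+n x) sx<r))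

shift-unshift : ∀ r x → r ≢ x → shift r (unshift r x) ≡ x
shift-unshift r x r≢x with x <? r
... | yes x<r = shift-< x<r
shift-unshift zero zero r≢x | no _ = contradiction refl r≢x
shift-unshift (suc r) zero r≢x | no x≮r = contradiction (s≤s z≤n) x≮r
shift-unshift r (suc x) r≢x | no x≮r = shift-≥ (ℕₚ.≤-pred (ℕₚ.≤∧≢⇒< (ℕₚ.≮⇒≥ x≮r) r≢x))

map-unshift-shift : ∀ r σ → map (unshift r) (map (shift r) σ) ≡ σ
map-unshift-shift r σ = trans (sym (map-∘ σ))
  (map-id-local {xs = σ} (All.tabulate (λ {x} _ → unshift-shift r x)))

map-shift-unshift : ∀ r {w} → Unique (r ∷ w) → map (shift r) (map (unshift r) w) ≡ w
map-shift-unshift r {w} (r∉ ∷ _) = trans (sym (map-∘ w)) (map-id-local (All.map (shift-unshift r _) r∉))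

map-unshift-range : ∀ m r {w} → 1 ≤ r → r ≤ suc m → r ∷ w ↭ range (suc m) →
  map (unshift r) w ↭ range m
map-unshift-range m r 1≤r r≤ p = ↭-trans
  (↭ₚ.map⁺ (unshift r) (↭ₚ.drop-∷ (↭-trans p (↭-sym (range-shift m r 1≤r r≤)))))
  (↭-reflexive (map-unshift-shift r (range m)))

++-injective : ∀ {A : Set} (xs xs′ : List A) {ys ys′} →
  length xs ≡ length xs′ → xs ++ ys ≡ xs′ ++ ys′ → xs ≡ xs′ × ys ≡ ys′
++-injective [] [] _ eq = refl , eq
++-injective (x ∷ xs) (x′ ∷ xs′) len eq with ∷-injective eq
... | refl , eq′ with ++-injective xs xs′ (ℕₚ.suc-injective len) eq′
...   | refl , ys≡ys′ = refl , ys≡ys′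

Unique-map-∈ : ∀ {A B : Set} (f : A → B) {xs} →
  (∀ {x y} → x ∈ xs → y ∈ xs → f x ≡ f y → x ≡ y) → Unique xs → Unique (map f xs)
Unique-map-∈ f inj [] = []
Unique-map-∈ f {x ∷ xs} inj (x∉ ∷ u) =
  Allₚ.map⁺ (All.tabulate (λ y∈ fx≡fy → All.lookup x∉ y∈ (inj (here refl) (there y∈) fx≡fy)))
  ∷ Unique-map-∈ f (λ p q → inj (there p) (there q)) u

arrivals : ℕ → List ℕ → List ℕ → List (List ℕ × List ℕ)
arrivals r ds e = filter (startsWith? r ∘ proj₁) (unsweep ds e)

length-filter : ∀ {A : Set} {P : A → Set} (P? : ∀ x → Dec (P x)) xs →
  + length (filter P? xs) ≡ sumOver (λ x → branch (P? x) 1ℤ 0ℤ) xs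
length-filter P? [] = refl
length-filter P? (x ∷ xs) with P? x
... | yes _ = cong (λ z → 1ℤ ℤ.+ z) (length-filter P? xs)
... | no _ = trans (length-filter P? xs) (sym (ℤₚ.+-identityˡ _))

-- The row occupies the leftmost sites and hence comes first; `drop 1` removes the extra chip `r`.
readSigma : ℕ → List ℕ × List ℕ → List ℕ
readSigma r (xs , e) = map (unshift r) (e ++ drop 1 xs)

sigmas : ℕ → List ℕ → List ℕ → List (List ℕ)
sigmas r ds e = map (readSigma r) (arrivals r ds e)

arrivals⁻ : ∀ {r ds e xs e₀} → (xs , e₀) ∈ arrivals r ds e →
  ∃ λ ys → xs ≡ r ∷ ys × Sweep (r ∷ ys) e₀ ds e
arrivals⁻ {r} {ds} {e} p with ∈ₚ.∈-filter⁻ (startsWith? r ∘ proj₁) {xs = unsweep ds e} p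
arrivals⁻ {r} {ds} {e} {_ ∷ ys} p | q , refl = ys , refl , unsweep-sound ds e q

arrivals⁺ : ∀ {r ds e xs e₀} → Sweep (r ∷ xs) e₀ ds e → (r ∷ xs , e₀) ∈ arrivals r ds e
arrivals⁺ {r} sw = ∈ₚ.∈-filter⁺ (startsWith? r ∘ proj₁) (unsweep-complete sw) refl

Sweep-initial-↭ : ∀ {r xs e₀ ds e} → Sweep (r ∷ xs) e₀ ds e → r ∷ e₀ ++ xs ↭ ds ++ e
Sweep-initial-↭ {r} {xs} {e₀} sw = ↭-trans (↭-prep r (↭ₚ.++-comm e₀ xs)) (Sweep-↭ sw)

sigmas-unique : ∀ r ds e → Unique (ds ++ e) → Unique (sigmas r ds e)
sigmas-unique r ds e u = Unique-map-∈ (readSigma r) injective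
  (Uniqueₚ.filter⁺ (startsWith? r ∘ proj₁) (unsweep-unique ds e))
  where
  injective : ∀ {s t} → s ∈ arrivals r ds e → t ∈ arrivals r ds e →
    readSigma r s ≡ readSigma r t → s ≡ t
  injective {_ , e₀} {_ , e₁} p q eq with arrivals⁻ {r} {ds} p | arrivals⁻ {r} {ds} q
  ... | xs , refl , sw | ys , refl , sw′
    -- Both initial rows are as long as `e`, so equal words split into equal rows and equal
    -- remainders.
    with ++-injective e₀ e₁ (trans (Sweep-lengthʳ sw) (sym (Sweep-lengthʳ sw′)))
           (trans (sym (map-shift-unshift r (Unique-resp-↭ (↭-sym (Sweep-initial-↭ sw)) u)))
           (trans (cong (map (shift r)) eq)
                  (map-shift-unshift r (Unique-resp-↭ (↭-sym (Sweep-initial-↭ sw′)) u))))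
  ... | refl , refl = refl

-- A row of p chips leaves n - p outputs, so the sweep cuts π into π^left and π^right. This serves
-- both the configuration witnessing that π is resultant and an arbitrary σ.
TopplesTo⇒Sweep-split : ∀ {w x n p π} → x ∷ w ↭ range n → length w ≡ n ∸ 1 → p ≤ n ∸ 1 →
  TopplesTo (initConfig w x p) π → π ↭ range n →
  Sweep (x ∷ drop p w) (take p w) (take (n ∸ p) π) (drop (n ∸ p) π)
TopplesTo⇒Sweep-split {w} {x} {n} {p} {π} w↭ len p≤ t π↭ = conclude (TopplesTo⇒Sweep unique t′)
  where
  length-e : length (take p w) ≡ p
  length-e = trans (length-take p w) (ℕₚ.m≤n⇒m⊓n≡m (subst (p ≤_) (sym len) p≤))
  t′ : TopplesTo (initConfig (take p w ++ drop p w) x (length (take p w))) π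
  t′ = subst₂ (λ v q → TopplesTo (initConfig v x q) π) (sym (take++drop≡id p w)) (sym length-e) t
  unique : Unique (x ∷ drop p w ++ take p w)
  unique = Unique-resp-↭ (↭-sym (↭-trans
    (↭-prep x (↭-trans (↭ₚ.++-comm (drop p w) (take p w)) (↭-reflexive (take++drop≡id p w)))) w↭))
    (range-unique n)
  conclude : (∃₂ λ ds e → Sweep (x ∷ drop p w) (take p w) ds e × π ≡ ds ++ e) →
    Sweep (x ∷ drop p w) (take p w) (take (n ∸ p) π) (drop (n ∸ p) π)
  conclude (ds , e , sw , π≡) with ++-injective ds (take (n ∸ p) π) length-ds
                                     (trans (sym π≡) (sym (take++drop≡id (n ∸ p) π)))
    where
    length-π : length π ≡ n
    length-π = trans (↭ₚ.↭-length π↭) (length-range n)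
    length-ds : length ds ≡ length (take (n ∸ p) π)
    length-ds = trans (sym (ℕₚ.m+n∸n≡m (length ds) (length e)))
      (trans (cong₂ _∸_
               (trans (sym (length-++ ds)) (trans (cong length (sym π≡)) length-π))
               (trans (sym (Sweep-lengthʳ sw)) length-e))
      (sym (trans (length-take (n ∸ p) π)
             (ℕₚ.m≤n⇒m⊓n≡m (subst (n ∸ p ≤_) (sym length-π) (ℕₚ.m∸n≤m n p))))))
  ... | refl , refl = sw

theorem2p14 : (n p r : ℕ) (π : List ℕ) →
    2 ≤ n → 1 ≤ p → p ≤ n ∸ 1 → 1 ≤ r → r ≤ n ∸ p →
    π ↭ range n →
    Resultant n p π →
    r ∈ lrMaxima (take (n ∸ p) π) →
    let a = length (filter (_<? r) (lrMaxima (take (n ∸ p) π)))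
        b = length (filter (r <?_) (lrMaxima (take (n ∸ p) π)))
        k = length (rlMinima (drop (n ∸ p) π))
    in Σ (List (List ℕ)) λ L →
         Unique L ×
         ((σ : List ℕ) → (σ ∈ L) ⇔ ((σ ↭ range (n ∸ 1)) × TopplesTo (sigmaConfig σ r p) π)) ×
         (+ length L ≡ deltaPolyB a b k)
theorem2p14 n@(suc m) p r π _ _ p≤m 1≤r r≤n∸p π↭ (w , x , w↭ , length-w , t) r∈ =
  sigmas r left right ,
  sigmas-unique r left right split-unique ,
  (λ σ → mk⇔ (sound σ) (λ { (σ↭ , t′) → complete σ σ↭ t′ })) ,
  trans (cong +_ (length-map (readSigma r) (arrivals r left right)))
    (trans (length-filter (startsWith? r ∘ proj₁) (unsweep left right))
    (trans (sum-firstChip r left right split-unique (Sweep-separated reference) r∈)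
           (sym (deltaPolyB≡diffB (below r (lrMaxima left)) (above r (lrMaxima left)) (rlCount right)))))
  where
  left right : List ℕ
  left = take (n ∸ p) π
  right = drop (n ∸ p) π
  r≤n : r ≤ n
  r≤n = ℕₚ.≤-trans r≤n∸p (ℕₚ.m∸n≤m n p)
  split : left ++ right ≡ π
  split = take++drop≡id (n ∸ p) π
  split-↭ : left ++ right ↭ range n
  split-↭ = ↭-trans (↭-reflexive split) π↭
  split-unique : Unique (left ++ right)
  split-unique = Unique-resp-↭ (↭-sym split-↭) (range-unique n)
  -- Resultance of π enters here: some sweep ends in π, so all of `left` lies below all of `right`,
  -- and `right` has length p.
  reference : Sweep (x ∷ drop p w) (take p w) left right
  reference = TopplesTo⇒Sweep-split w↭ length-w p≤m t π↭
  length-right : length right ≡ p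
  length-right = trans (sym (Sweep-lengthʳ reference))
    (trans (length-take p w) (ℕₚ.m≤n⇒m⊓n≡m (subst (p ≤_) (sym length-w) p≤m)))
  sound : ∀ σ → σ ∈ sigmas r left right → (σ ↭ range m) × TopplesTo (sigmaConfig σ r p) π
  sound σ σ∈ with ∈ₚ.∈-map⁻ (readSigma r) σ∈
  ... | (_ , e₀) , s∈ , refl with arrivals⁻ {r} {left} s∈
  ...   | xs , refl , sw =
    map-unshift-range m r 1≤r r≤n (↭-trans (Sweep-initial-↭ sw) split-↭) ,
    subst₂ (λ v q → TopplesTo (initConfig v r q) π)
      (sym (map-shift-unshift r (Unique-resp-↭ (↭-sym (Sweep-initial-↭ sw)) split-unique)))
      (trans (Sweep-lengthʳ sw) length-right)
      (subst (TopplesTo (initConfig (e₀ ++ xs) r (length e₀))) split (Sweep⇒TopplesTo sw))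
  complete : ∀ σ → σ ↭ range m → TopplesTo (sigmaConfig σ r p) π → σ ∈ sigmas r left right
  complete σ σ↭ t′ = subst (_∈ sigmas r left right)
    (trans (cong (map (unshift r)) (take++drop≡id p v)) (map-unshift-shift r σ))
    (∈ₚ.∈-map⁺ (readSigma r) (arrivals⁺ (TopplesTo⇒Sweep-split
      (↭-trans (↭-prep r (↭ₚ.map⁺ (shift r) σ↭)) (range-shift m r 1≤r r≤n))
      (trans (length-map (shift r) σ) (trans (↭ₚ.↭-length σ↭) (length-range m)))
      p≤m t′ π↭)))
    where
    v : List ℕ
    v = map (shift r) σ
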